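{- There exists a $9.38$-competitive algorithm for the preemptive online machine minimization problem when all processing times are equal, i.e. $p_j=p$ for all jobs $j$.
   Context: Machine minimization with deadlines: each job $j$ of a finite instance has integer release date $r_j$, processing time $p_j$ and deadline $d_j$. A feasible preemptive schedule on a given number of identical machines processes each job for $p_j$ units within $[r_j,d_j]$, each machine processing at most one job at a time, no job on two machines at once; preemption and migration allowed. $m$ is the minimum number of machines admitting a feasible schedule. Online: each job becomes known only at its release date, the algorithm makes irrevocable decisions (including opening machines) over time and does not know $m$. An algorithm is $c$-competitive if on every instance it produces a feasible schedule using at most $c\cdot m$ machines. -}

module Defs where

open import Data.Nat as ℕ using (ℕ; _<?_)
open import Data.Integer using (+_)
open import Data.Rational as ℚ using (ℚ; _/_; _-_; 0ℚ)
open import Data.Bool using (if_then_else_)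
open import Data.List using (List; length; lookup; map; filter; foldr)
open import Data.List.Relation.Unary.All using (All)
open import Data.List.Relation.Unary.Any using (Any)
open import Data.List.Relation.Unary.Linked using (Linked)
open import Data.Fin using (Fin)
open import Data.Product using (Σ; ∃; _×_)
open import Data.Sum using (_⊎_)
open import Function.Bundles using (_⇔_)
open import Relation.Binary.PropositionalEquality using (_≡_; _≢_)

-- A job: integer release date r, processing time p, deadline d.
record Job : Set where
  constructor job
  field
    r p d : ℕ
open Job public

-- A finite instance; job j is the job at position j of the list.
Instance : Set
Instance = List Job

-- A piece of a preemptive schedule: job `jb` runs on machine `mach`
-- during the (rational) time interval [start , end).
record Piece : Set where
  constructor piece
  field
    jb mach : ℕ
    start end : ℚ
open Piece public

Schedule : Set
Schedule = List Piece

ℕ→ℚ : ℕ → ℚ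
ℕ→ℚ n = + n / 1

Disjoint : Piece → Piece → Set
Disjoint a b = (end a ℚ.≤ start b) ⊎ (end b ℚ.≤ start a)

processed : Schedule → ℕ → ℚ
processed S j = foldr ℚ._+_ 0ℚ (map (λ π → if jb π ℕ.≡ᵇ j then end π - start π else 0ℚ) S)

-- S is a feasible preemptive schedule for I on M machines (migration allowed)
record Feasible (I : Instance) (M : ℕ) (S : Schedule) : Set where
  field
    wellformed : All (λ π → (jb π ℕ.< length I) × (mach π ℕ.< M) × (start π ℚ.< end π)) S
    window     : (k : Fin (length S)) → (i : Fin (length I)) →
                 jb (lookup S k) ≡ Data.Fin.toℕ i →
                 (ℕ→ℚ (r (lookup I i)) ℚ.≤ start (lookup S k)) × (end (lookup S k) ℚ.≤ ℕ→ℚ (d (lookup I i)))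
    machineOK  : (k k′ : Fin (length S)) → k ≢ k′ →
                 mach (lookup S k) ≡ mach (lookup S k′) → Disjoint (lookup S k) (lookup S k′)
    jobOK      : (k k′ : Fin (length S)) → k ≢ k′ →
                 jb (lookup S k) ≡ jb (lookup S k′) → Disjoint (lookup S k) (lookup S k′)
    amount     : (i : Fin (length I)) → processed S (Data.Fin.toℕ i) ≡ ℕ→ℚ (p (lookup I i))

MinMachines : Instance → ℕ → Set
MinMachines I m = (∃ λ S → Feasible I m S) × (∀ M S → Feasible I M S → m ℕ.≤ M)

EqualP : Instance → Set
EqualP I = ∃ λ p₀ → All (λ j → p j ≡ p₀) I

SortedByRelease : Instance → Set
SortedByRelease = Linked (λ a b → r a ℕ.≤ r b)

-- jobs released strictly before time t (a prefix of a sorted instance)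
releasedBefore : ℕ → Instance → Instance
releasedBefore t = filter (λ j → r j <? t)

Runs : Schedule → ℕ → ℕ → ℚ → Set
Runs S k j s = Any (λ π → (jb π ≡ j) × (mach π ≡ k) × (start π ℚ.≤ s) × (s ℚ.< end π)) S

ValidInput : Instance → Set
ValidInput I = SortedByRelease I × EqualP I

-- An algorithm maps instances to schedules; it is online (non-anticipating)
-- if what it does during [0,t) depends only on the jobs released before t.
Online : (Instance → Schedule) → Set
Online A = ∀ (I I′ : Instance) (t : ℕ) → ValidInput I → ValidInput I′ →
           releasedBefore t I ≡ releasedBefore t I′ →
           ∀ (j k : ℕ) (s : ℚ) → j ℕ.< length (releasedBefore t I) → s ℚ.< ℕ→ℚ t →
           Runs (A I) k j s ⇔ Runs (A I′) k j s

Competitive : ℕ → ℕ → (Instance → Schedule) → Set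
Competitive num den A = ∀ (I : Instance) → ValidInput I → ∀ m → MinMachines I m →
  ∃ λ M → Feasible I M (A I) × (den ℕ.* M ℕ.≤ num ℕ.* m)

{-# OPTIONS --safe #-}
module Submission where

open import Defs
open import Data.Bool using (if_then_else_; true; false)
open import Data.Empty using (⊥-elim)
open import Data.Fin using (Fin; zero; suc; toℕ; fromℕ<)
open import Data.Fin.Properties using (toℕ-fromℕ<; toℕ<n; toℕ-injective)
import Data.Integer as ℤ
import Data.Integer.Properties as ℤₚ
open import Data.List using ([]; _∷_; length; lookup; foldr; applyUpTo)
open import Data.List.Membership.Propositional.Properties using (∈-lookup)
open import Data.List.Properties
  using (length-applyUpTo; lookup-applyUpTo; map-applyUpTo; filter-none; filter-accept; length-filter)
open import Data.List.Relation.Unary.All as All using (All; []; _∷_)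
import Data.List.Relation.Unary.All.Properties as Allₚ
open import Data.List.Relation.Unary.AllPairs using (AllPairs; []; _∷_)
import Data.List.Relation.Unary.Any.Properties as Anyₚ
open import Data.List.Relation.Unary.Linked.Properties using (Linked⇒AllPairs)
open import Data.Maybe as Maybe using (Maybe; just; nothing)
open import Data.Nat as ℕ using (ℕ; zero; suc; _+_; _*_; _∸_; _^_; _⊔_; _≤_; _<_; z≤n; s≤s; _/_; _%_)
open import Data.Nat.DivMod
open import Data.Nat.Properties as ℕₚ
open import Data.Nat.Tactic.RingSolver using (solve-∀)
open import Data.Product using (∃; _×_; _,_; proj₁; proj₂)
open import Data.Rational as ℚ using (ℚ; 0ℚ)
import Data.Rational.Properties as ℚₚ
open import Data.Rational.Solver using (module +-*-Solver)
import Data.Rational.Unnormalised as ℚᵘ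
import Data.Rational.Unnormalised.Properties as ℚᵘₚ
open import Data.Sum using (_⊎_; inj₁; inj₂; [_,_]′)
open import Function using (_∘_; id; mk⇔)
open import Level using (0ℓ)
open import Relation.Binary.Definitions using (tri<; tri≈; tri>)
open import Relation.Binary.PropositionalEquality hiding (J)
open import Relation.Nullary using (¬_; Dec; yes; no; contradiction)
open import Relation.Nullary.Decidable using (_×-dec_; ¬?)
open import Relation.Unary using (Pred; Decidable)

-- The schedule is non-preemptive and uses 9m machines; p is the common processing time.
--
-- A tight job (d < r + 3p) starts at its release.  The tight jobs running at the release of a job j
-- have windows inside [r_j - p, r_j + 3p], so there are at most 4m of them and greedy colouring
-- of the jobs in release order needs 4m machines.
--
-- A loose job is run in one slot [kp, (k+1)p); after rounding its window to whole slots it is a unit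
-- job with at least two admissible slots.  Slot k runs up to 5·g jobs of earliest deadline, where
-- g ≤ m is the largest load of an interval (extended by p to both sides, which undoes the rounding)
-- by the jobs known so far.  If a deadline D were missed, all slots from some s up to D
-- would be full with jobs released after s and due by D.  But jobs released between 2b and 4b slots
-- before D are all known in the b slots at distance b, …, 2b-1 from D, and each of these has capacity at
-- least 1/b of their number because 5b ≥ 4b + 1.  Summing over b = 1, 2, 4, … gives a contradiction.

-- Counting the indices below a bound that satisfy a predicate

cnt : {P : Pred ℕ 0ℓ} → Decidable P → ℕ → ℕ
cnt P? zero    = 0
cnt P? (suc n) with P? n
... | yes _ = suc (cnt P? n)
... | no  _ = cnt P? n

private variable P Q R : Pred ℕ 0ℓ

cnt-≤ : (P? : Decidable P) → ∀ n → cnt P? n ≤ n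
cnt-≤ P? zero = z≤n
cnt-≤ P? (suc n) with P? n
... | yes _ = s≤s (cnt-≤ P? n)
... | no  _ = m≤n⇒m≤1+n (cnt-≤ P? n)

cnt-mono : (P? : Decidable P) (Q? : Decidable Q) → ∀ n →
           (∀ i → i < n → P i → Q i) → cnt P? n ≤ cnt Q? n
cnt-mono P? Q? zero    f = z≤n
cnt-mono P? Q? (suc n) f with P? n | Q? n | cnt-mono P? Q? n (λ i i<n → f i (m≤n⇒m≤1+n i<n))
... | yes _ | yes _ | ih = s≤s ih
... | yes x | no ¬y | _  = contradiction (f n ≤-refl x) ¬y
... | no  _ | yes _ | ih = m≤n⇒m≤1+n ih
... | no  _ | no  _ | ih = ih

cnt-strict : (P? : Decidable P) (Q? : Decidable Q) → ∀ n →
             (∀ i → i < n → P i → Q i) → ∀ {j} → j < n → Q j → ¬ P j → cnt P? n < cnt Q? n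
cnt-strict P? Q? (suc n) f {j} j<n q ¬p with j ℕₚ.≟ n | cnt-mono P? Q? n (λ i i<n → f i (m≤n⇒m≤1+n i<n))
... | yes refl | ih with P? n | Q? n
...   | yes x | _     = contradiction x ¬p
...   | no  _ | no ¬y = contradiction q ¬y
...   | no  _ | yes _ = s≤s ih
cnt-strict P? Q? (suc n) f {j} j<n q ¬p | no j≢n | _
  with P? n | Q? n | cnt-strict P? Q? n (λ i i<n → f i (m≤n⇒m≤1+n i<n)) (≤∧≢⇒< (ℕ.s≤s⁻¹ j<n) j≢n) q ¬p
... | yes _ | yes _ | ih = s≤s ih
... | yes x | no ¬y | _  = contradiction (f n ≤-refl x) ¬y
... | no  _ | yes _ | ih = m≤n⇒m≤1+n ih
... | no  _ | no  _ | ih = ih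

cnt-none : (P? : Decidable P) → ∀ n → (∀ i → i < n → ¬ P i) → cnt P? n ≡ 0
cnt-none P? zero    f = refl
cnt-none P? (suc n) f with P? n
... | yes x = contradiction x (f n ≤-refl)
... | no  _ = cnt-none P? n (λ i i<n → f i (m≤n⇒m≤1+n i<n))

cnt-pos : (P? : Decidable P) → ∀ n {j} → j < n → P j → 1 ≤ cnt P? n
cnt-pos P? (suc n) {j} j<n x with P? n
... | yes _ = s≤s z≤n
... | no ¬x with j ℕₚ.≟ n
...   | yes refl = contradiction x ¬x
...   | no j≢n = cnt-pos P? n (≤∧≢⇒< (ℕ.s≤s⁻¹ j<n) j≢n) x

cnt-cover : (P? : Decidable P) (Q? : Decidable Q) (R? : Decidable R) → ∀ n →
            (∀ i → i < n → P i → Q i ⊎ R i) → cnt P? n ≤ cnt Q? n + cnt R? n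
cnt-cover P? Q? R? zero    f = z≤n
cnt-cover P? Q? R? (suc n) f
  with P? n | Q? n | R? n | cnt-cover P? Q? R? n (λ i i<n → f i (m≤n⇒m≤1+n i<n))
... | no _  | no _  | no _  | ih = ih
... | no _  | no _  | yes _ | ih = ≤-trans ih (+-monoʳ-≤ (cnt Q? n) (n≤1+n _))
... | no _  | yes _ | no _  | ih = m≤n⇒m≤1+n ih
... | no _  | yes _ | yes _ | ih = m≤n⇒m≤1+n (≤-trans ih (+-monoʳ-≤ (cnt Q? n) (n≤1+n _)))
... | yes _ | yes _ | no _  | ih = s≤s ih
... | yes _ | yes _ | yes _ | ih = s≤s (≤-trans ih (+-monoʳ-≤ (cnt Q? n) (n≤1+n _)))
... | yes _ | no _  | yes _ | ih = ≤-trans (s≤s ih) (≤-reflexive (sym (+-suc (cnt Q? n) _)))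
... | yes x | no ¬q | no ¬r | _  = [ (λ q → contradiction q ¬q) , (λ r → contradiction r ¬r) ]′ (f n ≤-refl x)

-- Natural numbers as rationals

ℕ→ℚ-+ : ∀ m n → ℕ→ℚ (m + n) ≡ ℕ→ℚ m ℚ.+ ℕ→ℚ n
ℕ→ℚ-+ m n = ℚₚ.toℚᵘ-injective (begin
  -- `ℕ→ℚ` normalises its fraction by a gcd, which does not compute for a variable argument.
  -- Unnormalised fractions with denominator 1 avoid this, here and in the monotonicity lemmas.
  ℚ.toℚᵘ (ℕ→ℚ (m + n))                        ≈⟨ ℚₚ.toℚᵘ-fromℚᵘ (ℚᵘ.mkℚᵘ (ℤ.+ (m + n)) 0) ⟩
  ℚᵘ.mkℚᵘ (ℤ.+ (m + n)) 0                        ≈⟨ ℚᵘ.*≡* (cong (ℤ._* ℤ.+ 1)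
      (sym (cong₂ ℤ._+_ (ℤₚ.*-identityʳ (ℤ.+ m)) (ℤₚ.*-identityʳ (ℤ.+ n))))) ⟩
  ℚᵘ.mkℚᵘ (ℤ.+ m) 0 ℚᵘ.+ ℚᵘ.mkℚᵘ (ℤ.+ n) 0         ≈⟨ ℚᵘₚ.+-cong (ℚₚ.toℚᵘ-fromℚᵘ (ℚᵘ.mkℚᵘ (ℤ.+ m) 0))
      (ℚₚ.toℚᵘ-fromℚᵘ (ℚᵘ.mkℚᵘ (ℤ.+ n) 0)) ⟨
  ℚ.toℚᵘ (ℕ→ℚ m) ℚᵘ.+ ℚ.toℚᵘ (ℕ→ℚ n)           ≈⟨ ℚₚ.toℚᵘ-homo-+ (ℕ→ℚ m) (ℕ→ℚ n) ⟨
  ℚ.toℚᵘ (ℕ→ℚ m ℚ.+ ℕ→ℚ n)                     ∎)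
  where open ℚᵘₚ.≃-Reasoning

ℕ→ℚ-mono-≤ : ∀ {m n} → m ≤ n → ℕ→ℚ m ℚ.≤ ℕ→ℚ n
ℕ→ℚ-mono-≤ {m} {n} m≤n = ℚₚ.toℚᵘ-cancel-≤ (begin
  ℚ.toℚᵘ (ℕ→ℚ m)    ≃⟨ ℚₚ.toℚᵘ-fromℚᵘ (ℚᵘ.mkℚᵘ (ℤ.+ m) 0) ⟩
  ℚᵘ.mkℚᵘ (ℤ.+ m) 0   ≤⟨ ℚᵘ.*≤* (ℤₚ.*-monoʳ-≤-nonNeg (ℤ.+ 1) (ℤ.+≤+ m≤n)) ⟩
  ℚᵘ.mkℚᵘ (ℤ.+ n) 0   ≃⟨ ℚₚ.toℚᵘ-fromℚᵘ (ℚᵘ.mkℚᵘ (ℤ.+ n) 0) ⟨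
  ℚ.toℚᵘ (ℕ→ℚ n)    ∎)
  where open ℚᵘₚ.≤-Reasoning

ℕ→ℚ-mono-< : ∀ {m n} → m < n → ℕ→ℚ m ℚ.< ℕ→ℚ n
ℕ→ℚ-mono-< {m} {n} m<n = ℚₚ.toℚᵘ-cancel-< (begin-strict
  ℚ.toℚᵘ (ℕ→ℚ m)    ≃⟨ ℚₚ.toℚᵘ-fromℚᵘ (ℚᵘ.mkℚᵘ (ℤ.+ m) 0) ⟩
  ℚᵘ.mkℚᵘ (ℤ.+ m) 0   <⟨ ℚᵘ.*<* (ℤₚ.*-monoʳ-<-pos (ℤ.+ 1) (ℤ.+<+ m<n)) ⟩
  ℚᵘ.mkℚᵘ (ℤ.+ n) 0   ≃⟨ ℚₚ.toℚᵘ-fromℚᵘ (ℚᵘ.mkℚᵘ (ℤ.+ n) 0) ⟨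
  ℚ.toℚᵘ (ℕ→ℚ n)    ∎)
  where open ℚᵘₚ.≤-Reasoning

ℕ→ℚ-cancel-≤ : ∀ {m n} → ℕ→ℚ m ℚ.≤ ℕ→ℚ n → m ≤ n
ℕ→ℚ-cancel-≤ {m} {n} h with m ≤? n
... | yes m≤n = m≤n
... | no  m≰n = contradiction (ℚₚ.<-≤-trans (ℕ→ℚ-mono-< (≰⇒> m≰n)) h) (ℚₚ.<-irrefl refl)

ℕ→ℚ-cancel-< : ∀ {m n} → ℕ→ℚ m ℚ.< ℕ→ℚ n → m < n
ℕ→ℚ-cancel-< {m} {n} h with m <? n
... | yes m<n = m<n
... | no  m≮n = contradiction (ℚₚ.<-≤-trans h (ℕ→ℚ-mono-≤ (≮⇒≥ m≮n))) (ℚₚ.<-irrefl refl)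

ℕ→ℚ-length : ∀ a l → ℕ→ℚ (a + l) ℚ.- ℕ→ℚ a ≡ ℕ→ℚ l
ℕ→ℚ-length a l = trans (cong (ℚ._- ℕ→ℚ a) (ℕ→ℚ-+ a l))
  (solve 2 (λ x y → (x :+ y) :- x := y) refl (ℕ→ℚ a) (ℕ→ℚ l))
  where open +-*-Solver

-- Total length of sets of pieces

len : Piece → ℚ
len π = end π ℚ.- start π

-- Generalises `processed` from a single job to any decidable set of pieces, so that a sum can be
-- split by job, by machine or by position in time.
sel : {P : Pred Piece 0ℓ} → Decidable P → Schedule → ℚ
sel P? []      = 0ℚ
sel P? (π ∷ S) with P? π
... | yes _ = len π ℚ.+ sel P? S
... | no  _ = sel P? S

private variable A B C : Pred Piece 0ℓ

sel-cong : (A? : Decidable A) (B? : Decidable B) → ∀ S →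
           (∀ k → A (lookup S k) → B (lookup S k)) → (∀ k → B (lookup S k) → A (lookup S k)) →
           sel A? S ≡ sel B? S
sel-cong A? B? []      f g = refl
sel-cong A? B? (π ∷ S) f g with A? π | B? π
... | yes _ | yes _ = cong (len π ℚ.+_) (sel-cong A? B? S (f ∘ suc) (g ∘ suc))
... | yes a | no ¬b = contradiction (f zero a) ¬b
... | no ¬a | yes b = contradiction (g zero b) ¬a
... | no _  | no _  = sel-cong A? B? S (f ∘ suc) (g ∘ suc)

sel-none : (A? : Decidable A) → ∀ S → (∀ k → ¬ A (lookup S k)) → sel A? S ≡ 0ℚ
sel-none A? []      f = refl
sel-none A? (π ∷ S) f with A? π
... | yes a = contradiction a (f zero)
... | no  _ = sel-none A? S (f ∘ suc)

sel-split : (A? : Decidable A) (B? : Decidable B) → ∀ S →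
            sel A? S ≡ sel (λ π → A? π ×-dec B? π) S ℚ.+ sel (λ π → A? π ×-dec ¬? (B? π)) S
sel-split A? B? []      = refl
sel-split A? B? (π ∷ S) with A? π | B? π | sel-split A? B? S
... | no _  | yes _ | ih = ih
... | no _  | no _  | ih = ih
... | yes _ | yes _ | ih = trans (cong (len π ℚ.+_) ih) (sym (ℚₚ.+-assoc (len π) _ _))
... | yes _ | no _  | ih = trans (cong (len π ℚ.+_) ih)
  (solve 3 (λ x y z → x :+ (y :+ z) := y :+ (x :+ z)) refl (len π)
    (sel (λ ρ → A? ρ ×-dec B? ρ) S) (sel (λ ρ → A? ρ ×-dec ¬? (B? ρ)) S))
  where open +-*-Solver

-- The first interval splits [a, b] into a left and a right part, and every other interval lies in one of them.
disjoint-length : (A? : Decidable A) → ∀ S a b → a ℚ.≤ b →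
  (∀ k → A (lookup S k) → (a ℚ.≤ start (lookup S k)) × (start (lookup S k) ℚ.≤ end (lookup S k)) ×
      (end (lookup S k) ℚ.≤ b)) →
  (∀ k k′ → k ≢ k′ → A (lookup S k) → A (lookup S k′) → Disjoint (lookup S k) (lookup S k′)) →
  sel A? S ℚ.≤ b ℚ.- a
disjoint-length A? [] a b a≤b win dis =
    ℚₚ.≤-trans (ℚₚ.≤-reflexive (sym (ℚₚ.+-inverseʳ a))) (ℚₚ.+-monoˡ-≤ (ℚ.- a) a≤b)
disjoint-length {A = A} A? (π ∷ S) a b a≤b win dis with A? π
... | no _   =
    disjoint-length A? S a b a≤b (λ k → win (suc k)) (λ k k′ ne → dis (suc k) (suc k′) (λ { refl → ne refl }))
... | yes aπ = begin
  len π ℚ.+ sel A? S                                        ≡⟨ cong (len π ℚ.+_) (sel-split A? left? S) ⟩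
  len π ℚ.+ (sel (λ ρ → A? ρ ×-dec left? ρ) S ℚ.+ sel (λ ρ → A? ρ ×-dec ¬? (left? ρ)) S)
    ≤⟨ ℚₚ.+-monoʳ-≤ (len π) (ℚₚ.+-mono-≤ leftBound rightBound) ⟩
  len π ℚ.+ ((start π ℚ.- a) ℚ.+ (b ℚ.- end π))
    ≡⟨ solve 4 (λ s e x y → (e :- s) :+ ((s :- x) :+ (y :- e)) := y :- x) refl (start π) (end π) a b ⟩
  b ℚ.- a ∎
  where
  open ℚₚ.≤-Reasoning hiding (start)
  open +-*-Solver using (solve; _:+_; _:-_; _:=_)
  left? : Decidable (λ ρ → end ρ ℚ.≤ start π)
  left? ρ = end ρ ℚₚ.≤? start π
  w = win zero aπ
  right : ∀ k → A (lookup S k) → ¬ (end (lookup S k) ℚ.≤ start π) → end π ℚ.≤ start (lookup S k)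
  right k ak ¬l with dis zero (suc k) (λ ()) aπ ak
  ... | inj₁ r = r
  ... | inj₂ l = contradiction l ¬l
  dis′ : ∀ k k′ → k ≢ k′ → A (lookup S k) → A (lookup S k′) → Disjoint (lookup S k) (lookup S k′)
  dis′ k k′ ne = dis (suc k) (suc k′) (λ { refl → ne refl })
  leftBound : sel (λ ρ → A? ρ ×-dec left? ρ) S ℚ.≤ start π ℚ.- a
  leftBound = disjoint-length (λ ρ → A? ρ ×-dec left? ρ) S a (start π) (proj₁ w)
    (λ k (ak , l) → let (x , y , _) = win (suc k) ak in x , y , l)
    (λ k k′ ne (ak , _) (ak′ , _) → dis′ k k′ ne ak ak′)
  rightBound : sel (λ ρ → A? ρ ×-dec ¬? (left? ρ)) S ℚ.≤ b ℚ.- end π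
  rightBound = disjoint-length (λ ρ → A? ρ ×-dec ¬? (left? ρ)) S (end π) b (proj₂ (proj₂ w))
    (λ k (ak , ¬l) → let (_ , y , z) = win (suc k) ak in right k ak ¬l , y , z)
    (λ k k′ ne (ak , _) (ak′ , _) → dis′ k k′ ne ak ak′)

-- Induction on the number of machines: the selected pieces on the highest machine are pairwise
-- disjoint inside a window of length `l`, and the others use one machine fewer.
machines-length : ∀ M → (A? : Decidable A) → ∀ S a l →
  (∀ k → A (lookup S k) → (ℕ→ℚ a ℚ.≤ start (lookup S k)) × (start (lookup S k) ℚ.≤ end (lookup S k)) ×
      (end (lookup S k) ℚ.≤ ℕ→ℚ (a + l))) →
  (∀ k k′ → k ≢ k′ → mach (lookup S k) ≡ mach (lookup S k′) → Disjoint (lookup S k) (lookup S k′)) →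
  (∀ k → A (lookup S k) → mach (lookup S k) < M) →
  sel A? S ℚ.≤ ℕ→ℚ (M * l)
machines-length zero A? S a l win dis bnd =
  ℚₚ.≤-reflexive (sel-none A? S (λ k ak → contradiction (bnd k ak) (λ ())))
machines-length (suc M) A? S a l win dis bnd = begin
  sel A? S                                            ≡⟨ sel-split A? low? S ⟩
  sel (λ π → A? π ×-dec low? π) S ℚ.+ sel (λ π → A? π ×-dec ¬? (low? π)) S
    ≤⟨ ℚₚ.+-mono-≤
         (machines-length M (λ π → A? π ×-dec low? π) S a l (λ k → win k ∘ proj₁) dis (λ _ → proj₂))
         (disjoint-length (λ π → A? π ×-dec ¬? (low? π)) S (ℕ→ℚ a) (ℕ→ℚ (a + l)) (ℕ→ℚ-mono-≤ (m≤m+n a l))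
           (λ k → win k ∘ proj₁) (λ k k′ ne x y → dis k k′ ne (trans (top k x) (sym (top k′ y))))) ⟩
  ℕ→ℚ (M * l) ℚ.+ (ℕ→ℚ (a + l) ℚ.- ℕ→ℚ a)             ≡⟨ cong (ℕ→ℚ (M * l) ℚ.+_) (ℕ→ℚ-length a l) ⟩
  ℕ→ℚ (M * l) ℚ.+ ℕ→ℚ l                               ≡⟨ ℕ→ℚ-+ (M * l) l ⟨
  ℕ→ℚ (M * l + l)                                     ≡⟨ cong ℕ→ℚ (+-comm (M * l) l) ⟩
  ℕ→ℚ (suc M * l)                                     ∎
  where
  open ℚₚ.≤-Reasoning hiding (start)
  low? : Decidable (λ π → mach π < M)
  low? π = mach π <? M
  top : ∀ k → _ × ¬ (mach (lookup S k) < M) → mach (lookup S k) ≡ M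
  top k (ak , ¬low) = ≤-antisym (ℕ.s≤s⁻¹ (bnd k ak)) (≮⇒≥ ¬low)

processed-sel : ∀ S j → processed S j ≡ sel (λ π → jb π ℕₚ.≟ j) S
processed-sel []      j = refl
processed-sel (π ∷ S) j with jb π ℕ.≡ᵇ j | ℕₚ.≡ᵇ⇒≡ (jb π) j | ℕₚ.≡⇒≡ᵇ (jb π) j | jb π ℕₚ.≟ j
... | true  | f | _ | yes _ = cong (len π ℚ.+_) (processed-sel S j)
... | true  | f | _ | no ne = contradiction (f _) ne
... | false | _ | g | yes e = ⊥-elim (g e)
... | false | _ | _ | no _  = trans (ℚₚ.+-identityˡ _) (processed-sel S j)

-- Volume bounds from a feasible schedule

infixl 10 _at_

-- Out of range indices denote a dummy job.
_at_ : Instance → ℕ → Job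
[]      at _     = job 0 0 0
(x ∷ I) at zero  = x
(x ∷ I) at suc i = I at i

at-lookup : ∀ I (i : Fin (length I)) → I at toℕ i ≡ lookup I i
at-lookup (x ∷ I) zero    = refl
at-lookup (x ∷ I) (suc i) = at-lookup I i

at-fromℕ< : ∀ I {i} (i<n : i < length I) → lookup I (fromℕ< i<n) ≡ I at i
at-fromℕ< I i<n = trans (sym (at-lookup I (fromℕ< i<n))) (cong (I at_) (toℕ-fromℕ< i<n))

module Load {I m S} (F : Feasible I m S) (p₀ : ℕ) (eqp : ∀ i → i < length I → p (I at i) ≡ p₀) where
  open Feasible F

  n = length I

  wf : ∀ k → (jb (lookup S k) < n) × (mach (lookup S k) < m) × (start (lookup S k) ℚ.< end (lookup S k))
  wf k = All.lookup wellformed (∈-lookup k)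

  window-at : ∀ k → (ℕ→ℚ (r (I at jb (lookup S k))) ℚ.≤ start (lookup S k)) ×
      (end (lookup S k) ℚ.≤ ℕ→ℚ (d (I at jb (lookup S k))))
  window-at k = subst (λ x → (ℕ→ℚ (r x) ℚ.≤ start (lookup S k)) × (end (lookup S k) ℚ.≤ ℕ→ℚ (d x)))
    (at-fromℕ< I (proj₁ (wf k))) (window k (fromℕ< (proj₁ (wf k))) (sym (toℕ-fromℕ< (proj₁ (wf k)))))

  amount-at : ∀ {i} → i < n → processed S i ≡ ℕ→ℚ p₀
  amount-at i<n = subst₂ (λ x y → processed S x ≡ ℕ→ℚ y) (toℕ-fromℕ< i<n)
    (trans (cong p (at-fromℕ< I i<n)) (eqp _ i<n)) (amount (fromℕ< i<n))

  module _ {B : Pred ℕ 0ℓ} (B? : Decidable B) where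

    below? : ∀ k → Decidable (λ π → jb π < k × B (jb π))
    below? k π = (jb π <? k) ×-dec B? (jb π)

    -- By induction on `k`: splitting off the jobs before `k` leaves the pieces of job `k` itself,
    -- which total `p₀` if `B k` holds and are not selected otherwise.
    jobs-length : ∀ k → k ≤ n → ℕ→ℚ (cnt B? k * p₀) ≡ sel (below? k) S
    jobs-length zero    _   = sym (sel-none (below? 0) S (λ _ ()))
    jobs-length (suc k) k<n =
        trans step (sym (trans (sel-split (below? (suc k)) (λ π → jb π <? k) S) (cong₂ ℚ._+_ low refl)))
      where
      low : sel (λ π → below? (suc k) π ×-dec (jb π <? k)) S ≡ sel (below? k) S
      low = sel-cong _ _ S (λ _ ((_ , b) , lt) → lt , b) (λ _ (lt , b) → (m≤n⇒m≤1+n lt , b) , lt)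
      step : ℕ→ℚ (cnt B? (suc k) * p₀) ≡ sel (below? k) S ℚ.+ sel (λ π → below? (suc k) π ×-dec ¬? (jb π <? k)) S
      step with B? k
      ... | yes b = trans (ℕ→ℚ-+ p₀ (cnt B? k * p₀)) (trans (ℚₚ.+-comm (ℕ→ℚ p₀) _)
        (cong₂ ℚ._+_ (jobs-length k (<⇒≤ k<n)) (trans (sym (amount-at k<n)) (trans (processed-sel S k)
          (sel-cong _ _ S (λ { κ refl → (≤-refl , b) , <-irrefl refl })
            (λ { κ ((lt , _) , ge) → ≤-antisym (ℕ.s≤s⁻¹ lt) (≮⇒≥ ge) }))))))
      ... | no ¬b = trans (jobs-length k (<⇒≤ k<n)) (trans (sym (ℚₚ.+-identityʳ _)) (cong (sel (below? k) S ℚ.+_)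
        (sym (sel-none _ S (λ κ ((lt , b) , ge) → ¬b (subst B (≤-antisym (ℕ.s≤s⁻¹ lt) (≮⇒≥ ge)) b))))))

    -- The jobs in `B` must be processed entirely inside an interval of length `l`, where `m`
    -- machines offer `m * l` units. Every lower bound on `m` comes from this inequality.
    load : ∀ a l → (∀ i → i < n → B i → a ≤ r (I at i) × d (I at i) ≤ a + l) → cnt B? n * p₀ ≤ m * l
    load a l win = ℕ→ℚ-cancel-≤ (ℚₚ.≤-trans (ℚₚ.≤-reflexive (jobs-length n ≤-refl))
      (machines-length m (below? n) S a l
        (λ k (lt , b) → let (x , y) = win _ lt b; (u , v) = window-at k in
           ℚₚ.≤-trans (ℕ→ℚ-mono-≤ x) u , ℚₚ.<⇒≤ (proj₂ (proj₂ (wf k))) , ℚₚ.≤-trans v (ℕ→ℚ-mono-≤ y))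
        machineOK (λ k _ → proj₁ (proj₂ (wf k)))))

  window-length : 1 ≤ p₀ → ∀ {i} → i < n → r (I at i) + p₀ ≤ d (I at i)
  window-length 1≤p {i} i<n with r (I at i) ≤? d (I at i)
  -- A window with `d < r` admits no piece, so the job would have been processed for 0 units.
  ... | no r≰d = contradiction
    (ℕ→ℚ-cancel-≤ (ℚₚ.≤-reflexive (trans (sym (amount-at i<n)) (trans (processed-sel S i) (sel-none _ S empty)))))
    (<⇒≱ 1≤p)
    where
    empty : ∀ k → jb (lookup S k) ≢ i
    empty k refl = r≰d (ℕ→ℚ-cancel-≤ (ℚₚ.≤-trans (proj₁ (window-at k))
      (ℚₚ.≤-trans (ℚₚ.<⇒≤ (proj₂ (proj₂ (wf k)))) (proj₂ (window-at k)))))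
  ... | yes r≤d = begin
    r₀ + p₀               ≤⟨ +-monoʳ-≤ r₀ (ℕ→ℚ-cancel-≤ bound) ⟩
    r₀ + (d (I at i) ∸ r₀) ≡⟨ m+[n∸m]≡n r≤d ⟩
    d (I at i)            ∎
    where
    open ≤-Reasoning hiding (start)
    r₀ = r (I at i)
    bound : ℕ→ℚ p₀ ℚ.≤ ℕ→ℚ (d (I at i) ∸ r₀)
    bound = subst₂ ℚ._≤_ (trans (sym (processed-sel S i)) (amount-at i<n))
      (trans (cong (λ x → ℕ→ℚ x ℚ.- ℕ→ℚ r₀) (sym (m+[n∸m]≡n r≤d))) (ℕ→ℚ-length r₀ (d (I at i) ∸ r₀)))
      (disjoint-length (λ π → jb π ℕₚ.≟ i) S (ℕ→ℚ r₀) (ℕ→ℚ (d (I at i))) (ℕ→ℚ-mono-≤ r≤d)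
        (λ { k refl → proj₁ (window-at k) , ℚₚ.<⇒≤ (proj₂ (proj₂ (wf k))) , proj₂ (window-at k) })
        (λ k k′ ne x y → jobOK k k′ ne (trans x (sym y))))

-- Counts and minimisers that ignore late indices

cnt-trunc : (P? : Decidable P) → ∀ b e → (∀ i → b ≤ i → i < e + b → ¬ P i) → cnt P? (e + b) ≡ cnt P? b
cnt-trunc P? b zero    f = refl
cnt-trunc P? b (suc e) f with P? (e + b)
... | yes x = contradiction x (f (e + b) (m≤n+m b e) ≤-refl)
... | no  _ = cnt-trunc P? b e (λ i b≤i i< → f i b≤i (m≤n⇒m≤1+n i<))

-- Meant for two instances of different lengths that share their first `b` jobs: the later jobs have
-- not arrived yet, so they fail both predicates and only the shared part is counted.
cnt-agree : (P? : Decidable P) (Q? : Decidable Q) → ∀ {b m n} → b ≤ m → b ≤ n →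
            (∀ i → b ≤ i → i < m → ¬ P i) → (∀ i → b ≤ i → i < n → ¬ Q i) →
            (∀ i → i < b → P i → Q i) → (∀ i → i < b → Q i → P i) → cnt P? m ≡ cnt Q? n
cnt-agree P? Q? {b} {m} {n} b≤m b≤n ¬p ¬q f g = begin
  cnt P? m             ≡⟨ cong (cnt P?) (m∸n+n≡m b≤m) ⟨
  cnt P? (m ∸ b + b)   ≡⟨ cnt-trunc P? b (m ∸ b) (λ i b≤i lt → ¬p i b≤i (subst (i <_) (m∸n+n≡m b≤m) lt)) ⟩
  cnt P? b             ≡⟨ ≤-antisym (cnt-mono P? Q? b f) (cnt-mono Q? P? b g) ⟩
  cnt Q? b             ≡⟨ cnt-trunc Q? b (n ∸ b) (λ i b≤i lt → ¬q i b≤i (subst (i <_) (m∸n+n≡m b≤n) lt)) ⟨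
  cnt Q? (n ∸ b + b)   ≡⟨ cong (cnt Q?) (m∸n+n≡m b≤n) ⟩
  cnt Q? n             ∎
  where open ≡-Reasoning

pick : ℕ → (ℕ → ℕ) → Maybe ℕ → Maybe ℕ
pick n key nothing  = just n
pick n key (just i) with key n <? key i
... | yes _ = just n
... | no  _ = just i

pick-cong : ∀ {n i key key′} → key n ≡ key′ n → key i ≡ key′ i → pick n key (just i) ≡ pick n key′ (just i)
pick-cong {n} {i} {key} {key′} e f with key n <? key i | key′ n <? key′ i
... | yes _ | yes _ = refl
... | no _  | no _  = refl
... | yes a | no b  = contradiction (subst₂ _<_ e f a) b
... | no a  | yes b = contradiction (subst₂ _<_ (sym e) (sym f) b) a

argmin : {P : Pred ℕ 0ℓ} → Decidable P → (ℕ → ℕ) → ℕ → Maybe ℕ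
argmin P? key zero    = nothing
argmin P? key (suc n) with P? n
... | yes _ = pick n key (argmin P? key n)
... | no  _ = argmin P? key n

argmin-nothing : (P? : Decidable P) (key : ℕ → ℕ) → ∀ n → argmin P? key n ≡ nothing → ∀ j → j < n → ¬ P j
argmin-nothing P? key (suc n) eq j j<n x with P? n
argmin-nothing P? key (suc n) eq j j<n x | yes _ with argmin P? key n
argmin-nothing P? key (suc n) () j j<n x | yes _ | nothing
... | just i with key n <? key i
argmin-nothing P? key (suc n) () j j<n x | yes _ | just i | yes _
argmin-nothing P? key (suc n) () j j<n x | yes _ | just i | no _
argmin-nothing P? key (suc n) eq j j<n x | no ¬p with j ℕₚ.≟ n
... | yes refl = ¬p x
... | no j≢n   = argmin-nothing P? key n eq j (≤∧≢⇒< (ℕ.s≤s⁻¹ j<n) j≢n) x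

IsArgmin : Pred ℕ 0ℓ → (ℕ → ℕ) → ℕ → ℕ → Set
IsArgmin P key n i = i < n × P i × (∀ j → j < n → P j → key i ≤ key j)

private
  <suc : ∀ {j n} → j < suc n → j ≢ n → j < n
  <suc j<n ne = ≤∧≢⇒< (ℕ.s≤s⁻¹ j<n) ne

argmin-just : (P? : Decidable P) (key : ℕ → ℕ) → ∀ n {i} → argmin P? key n ≡ just i → IsArgmin P key n i
argmin-just {P} P? key (suc n) eq with P? n
argmin-just {P} P? key (suc n) eq | yes x with argmin P? key n in e
argmin-just {P} P? key (suc n) refl | yes x | nothing = ≤-refl , x , min
  where
  min : ∀ j → j < suc n → P j → key n ≤ key j
  min j j<n y with j ℕₚ.≟ n
  ... | yes refl = ≤-refl
  ... | no ne    = contradiction y (argmin-nothing P? key n e j (<suc j<n ne))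
argmin-just {P} P? key (suc n) eq | yes x | just i₀ with key n <? key i₀ | argmin-just P? key n e
argmin-just {P} P? key (suc n) refl | yes x | just i₀ | yes lt | (_ , _ , h) = ≤-refl , x , min
  where
  min : ∀ j → j < suc n → P j → key n ≤ key j
  min j j<n y with j ℕₚ.≟ n
  ... | yes refl = ≤-refl
  ... | no ne    = ≤-trans (<⇒≤ lt) (h j (<suc j<n ne) y)
argmin-just {P} P? key (suc n) refl | yes x | just i₀ | no ge | (i<n , pi , h) = m≤n⇒m≤1+n i<n , pi , min
  where
  min : ∀ j → j < suc n → P j → key i₀ ≤ key j
  min j j<n y with j ℕₚ.≟ n
  ... | yes refl = ≮⇒≥ ge
  ... | no ne    = h j (<suc j<n ne) y
argmin-just {P} P? key (suc n) {i} eq | no ¬x with argmin-just P? key n eq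
... | (i<n , pi , h) = m≤n⇒m≤1+n i<n , pi , min
  where
  min : ∀ j → j < suc n → P j → key i ≤ key j
  min j j<n y with j ℕₚ.≟ n
  ... | yes refl = contradiction y ¬x
  ... | no ne    = h j (<suc j<n ne) y

argmin-trunc : (P? : Decidable P) (key : ℕ → ℕ) → ∀ b e → (∀ i → b ≤ i → i < e + b → ¬ P i) →
               argmin P? key (e + b) ≡ argmin P? key b
argmin-trunc P? key b zero    f = refl
argmin-trunc P? key b (suc e) f with P? (e + b)
... | yes x = contradiction x (f (e + b) (m≤n+m b e) ≤-refl)
... | no  _ = argmin-trunc P? key b e (λ i b≤i i< → f i b≤i (m≤n⇒m≤1+n i<))

argmin-cong : (P? : Decidable P) (Q? : Decidable Q) (key key′ : ℕ → ℕ) → ∀ n →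
              (∀ i → i < n → P i → Q i) → (∀ i → i < n → Q i → P i) → (∀ i → i < n → key i ≡ key′ i) →
              argmin P? key n ≡ argmin Q? key′ n
argmin-cong P? Q? key key′ zero    f g h = refl
argmin-cong P? Q? key key′ (suc n) f g h
  with P? n | Q? n | argmin-cong P? Q? key key′ n (λ i lt → f i (m≤n⇒m≤1+n lt))
      (λ i lt → g i (m≤n⇒m≤1+n lt)) (λ i lt → h i (m≤n⇒m≤1+n lt))
... | yes x | no ¬y | _ = contradiction (f n ≤-refl x) ¬y
... | no ¬x | yes y | _ = contradiction (g n ≤-refl y) ¬x
... | no _  | no _  | ih = ih
... | yes _ | yes _ | ih = trans lemma (cong (pick n key′) ih)
  where
  lemma : pick n key (argmin P? key n) ≡ pick n key′ (argmin P? key n)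
  lemma with argmin P? key n in e
  ... | nothing = refl
  -- The keys agree only in range, so the minimiser found so far has to be known to lie below `n`.
  ... | just i = pick-cong (h n ≤-refl) (h i (m≤n⇒m≤1+n (proj₁ (argmin-just P? key n e))))

argmin-agree : (P? : Decidable P) (Q? : Decidable Q) (key key′ : ℕ → ℕ) → ∀ {b m n} → b ≤ m → b ≤ n →
               (∀ i → b ≤ i → i < m → ¬ P i) → (∀ i → b ≤ i → i < n → ¬ Q i) →
               (∀ i → i < b → P i → Q i) → (∀ i → i < b → Q i → P i) → (∀ i → i < b → key i ≡ key′ i) →
               argmin P? key m ≡ argmin Q? key′ n
argmin-agree P? Q? key key′ {b} {m} {n} b≤m b≤n ¬p ¬q f g h = begin
  argmin P? key m             ≡⟨ cong (argmin P? key) (m∸n+n≡m b≤m) ⟨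
  argmin P? key (m ∸ b + b)   ≡⟨ argmin-trunc P? key b (m ∸ b)
      (λ i b≤i lt → ¬p i b≤i (subst (i <_) (m∸n+n≡m b≤m) lt)) ⟩
  argmin P? key b             ≡⟨ argmin-cong P? Q? key key′ b f g h ⟩
  argmin Q? key′ b            ≡⟨ argmin-trunc Q? key′ b (n ∸ b)
      (λ i b≤i lt → ¬q i b≤i (subst (i <_) (m∸n+n≡m b≤n) lt)) ⟨
  argmin Q? key′ (n ∸ b + b)  ≡⟨ cong (argmin Q? key′) (m∸n+n≡m b≤n) ⟩
  argmin Q? key′ n            ∎
  where open ≡-Reasoning

-- Finite maxima and sums

maxBelow : (ℕ → ℕ) → ℕ → ℕ
maxBelow f zero    = 0
maxBelow f (suc n) = f n ⊔ maxBelow f n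

maxBelow-upper : ∀ f n {i} → i < n → f i ≤ maxBelow f n
maxBelow-upper f (suc n) {i} i<n with i ℕₚ.≟ n
... | yes refl = m≤m⊔n (f n) _
... | no ne    = ≤-trans (maxBelow-upper f n (<suc i<n ne)) (m≤n⊔m (f n) _)

maxBelow-least : ∀ f n {x} → (∀ i → i < n → f i ≤ x) → maxBelow f n ≤ x
maxBelow-least f zero    h = z≤n
maxBelow-least f (suc n) h = ⊔-lub (h n ≤-refl) (maxBelow-least f n (λ i lt → h i (m≤n⇒m≤1+n lt)))

maxBelow-cong : ∀ {f g} n → (∀ i → f i ≡ g i) → maxBelow f n ≡ maxBelow g n
maxBelow-cong zero    h = refl
maxBelow-cong (suc n) h = cong₂ _⊔_ (h n) (maxBelow-cong n h)

sumBelow : (ℕ → ℕ) → ℕ → ℕ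
sumBelow f zero    = 0
sumBelow f (suc n) = sumBelow f n + f n

sumBelow-+ : ∀ f m n → sumBelow f (m + n) ≡ sumBelow f m + sumBelow (λ i → f (m + i)) n
sumBelow-+ f m zero    = trans (cong (sumBelow f) (+-identityʳ m)) (sym (+-identityʳ _))
sumBelow-+ f m (suc n) = begin
  sumBelow f (m + suc n)                                        ≡⟨ cong (sumBelow f) (+-suc m n) ⟩
  sumBelow f (m + n) + f (m + n)                                ≡⟨ cong (_+ f (m + n)) (sumBelow-+ f m n) ⟩
  sumBelow f m + sumBelow (λ i → f (m + i)) n + f (m + n)       ≡⟨ +-assoc (sumBelow f m) _ _ ⟩
  sumBelow f m + sumBelow (λ i → f (m + i)) (suc n)             ∎
  where open ≡-Reasoning

sumBelow-cong : ∀ {f g} n → (∀ i → i < n → f i ≡ g i) → sumBelow f n ≡ sumBelow g n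
sumBelow-cong zero    h = refl
sumBelow-cong (suc n) h = cong₂ _+_ (sumBelow-cong n (λ i lt → h i (m≤n⇒m≤1+n lt))) (h n ≤-refl)

sumBelow-monoʳ : ∀ f {m n} → m ≤ n → sumBelow f m ≤ sumBelow f n
sumBelow-monoʳ f {m} {n} m≤n = begin
  sumBelow f m             ≤⟨ m≤m+n _ _ ⟩
  sumBelow f m + sumBelow (λ i → f (m + i)) (n ∸ m) ≡⟨ sumBelow-+ f m (n ∸ m) ⟨
  sumBelow f (m + (n ∸ m)) ≡⟨ cong (sumBelow f) (m+[n∸m]≡n m≤n) ⟩
  sumBelow f n             ∎
  where open ≤-Reasoning hiding (start)

-- Averaging without division: the hypothesis says that each term is at least `c / b`. With `n`
-- equal to `b` the factor cancels and the sum is at least `c`.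
sumBelow-lower : ∀ f {b c} n → (∀ i → i < n → c ≤ b * f i) → n * c ≤ b * sumBelow f n
sumBelow-lower f {b} {c} zero    h = z≤n
sumBelow-lower f {b} {c} (suc n) h = begin
  c + n * c                        ≡⟨ +-comm c (n * c) ⟩
  n * c + c                        ≤⟨ +-mono-≤ (sumBelow-lower f {b} n (λ i lt → h i (m≤n⇒m≤1+n lt)))
      (h n ≤-refl) ⟩
  b * sumBelow f n + b * f n       ≡⟨ *-distribˡ-+ b _ _ ⟨
  b * sumBelow f (suc n)           ∎
  where open ≤-Reasoning hiding (start)

-- Least excluded value and the pigeonhole principle

bump : {P : Pred ℕ 0ℓ} → Decidable P → ℕ → ℕ
bump P? c with P? c
... | yes _ = suc c
... | no  _ = c

-- The candidate moves up only past a value in `P`. After `n` rounds it is the least value outside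
-- `P`, or `n` if all smaller values are in `P`.
mex : {P : Pred ℕ 0ℓ} → Decidable P → ℕ → ℕ
mex P? zero    = 0
mex P? (suc n) = bump P? (mex P? n)

mex-below : (P? : Decidable P) → ∀ n {c} → c < mex P? n → P c
mex-below P? (suc n) {c} lt with P? (mex P? n)
... | no _  = mex-below P? n lt
... | yes x with c ℕₚ.≟ mex P? n
...   | yes refl = x
...   | no ne    = mex-below P? n (<suc lt ne)

mex-spec : (P? : Decidable P) → ∀ n → ¬ P (mex P? n) ⊎ mex P? n ≡ n
mex-spec P? zero = inj₂ refl
mex-spec P? (suc n) with P? (mex P? n) | mex-spec P? n
... | no ¬x | _       = inj₁ ¬x
... | yes x | inj₁ ¬x = contradiction x ¬x
... | yes _ | inj₂ e  = inj₂ (cong suc e)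

bump-cong : (P? : Decidable P) (Q? : Decidable Q) → (∀ i → P i → Q i) →
    (∀ i → Q i → P i) → ∀ c → bump P? c ≡ bump Q? c
bump-cong P? Q? f g c with P? c | Q? c
... | yes _ | yes _ = refl
... | no _  | no _  = refl
... | yes x | no ¬y = contradiction (f c x) ¬y
... | no ¬x | yes y = contradiction (g c y) ¬x

mex-cong : (P? : Decidable P) (Q? : Decidable Q) → (∀ i → P i → Q i) →
    (∀ i → Q i → P i) → ∀ n → mex P? n ≡ mex Q? n
mex-cong P? Q? f g zero    = refl
mex-cong P? Q? f g (suc n) = trans (cong (bump P?) (mex-cong P? Q? f g n)) (bump-cong P? Q? f g (mex Q? n))

pigeonhole : (P? : Decidable P) (col : ℕ → ℕ) → ∀ N n →
             (∀ c → c < N → ∃ λ i → i < n × P i × col i ≡ c) → N ≤ cnt P? n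
pigeonhole {P} P? col N n f = ≤-trans (go N f) (cnt-mono _ P? n (λ _ _ → proj₁))
  where
  -- Restricting the count to indices of colour below `N` makes every further colour raise it
  -- strictly.
  low? : ∀ N → Decidable (λ i → P i × col i < N)
  low? N i = P? i ×-dec (col i <? N)
  go : ∀ N → (∀ c → c < N → ∃ λ i → i < n × P i × col i ≡ c) → N ≤ cnt (low? N) n
  go zero    f = z≤n
  go (suc N) f with f N ≤-refl
  ... | (i , i<n , x , e) = <-≤-trans (s≤s (go N (λ c lt → f c (m≤n⇒m≤1+n lt))))
    (cnt-strict (low? N) (low? (suc N)) n (λ _ _ (y , lt) → y , m≤n⇒m≤1+n lt) i<n (x , s≤s (≤-reflexive e))
        (λ (_ , lt) → <-irrefl e lt))

-- Placements

nothing? : ∀ {A : Set} (x : Maybe A) → Dec (x ≡ nothing)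
nothing? nothing  = yes refl
nothing? (just _) = no λ ()

-- Read in two ways: as (slot, position in the slot) while the loose jobs are distributed, and as
-- (start time, machine) for the final schedule.
Placement : Set
Placement = ℕ → Maybe (ℕ × ℕ)

place : Maybe ℕ → ℕ × ℕ → Placement → Placement
place nothing  v f = f
place (just i) v f j with j ℕₚ.≟ i
... | yes _ = just v
... | no  _ = f j

place-cong : ∀ x v {f g} → (∀ i → f i ≡ g i) → ∀ i → place x v f i ≡ place x v g i
place-cong nothing  v h i = h i
place-cong (just j) v h i with i ℕₚ.≟ j
... | yes _ = refl
... | no  _ = h i

-- Tight and loose jobs, and rounding to slots

module Classes (p′ : ℕ) (J : ℕ → Job) where

  q : ℕ
  q = suc p′

  Loose : Pred ℕ 0ℓ
  Loose i = r (J i) + 3 * q ≤ d (J i)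

  loose? : Decidable Loose
  loose? i = r (J i) + 3 * q ≤? d (J i)

  -- Release rounded up and deadline rounded down in units of `q`; the admissible slots of a job are
  -- those from `first` up to but excluding `deadline`.
  first deadline : ℕ → ℕ
  first    i = (r (J i) + p′) / q
  deadline i = d (J i) / q

  first-lower : ∀ i → r (J i) ≤ first i * q
  first-lower i = +-cancelʳ-≤ p′ _ _ (begin
    r (J i) + p′                             ≡⟨ m≡m%n+[m/n]*n (r (J i) + p′) q ⟩
    (r (J i) + p′) % q + first i * q         ≤⟨ +-monoˡ-≤ _ (m%n≤n′ (r (J i) + p′)) ⟩
    p′ + first i * q                         ≡⟨ +-comm p′ _ ⟩
    first i * q + p′                         ∎)
    where
    open ≤-Reasoning hiding (start)
    m%n≤n′ : ∀ x → x % q ≤ p′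
    m%n≤n′ x = ℕ.s≤s⁻¹ (m%n<n x q)

  first-upper : ∀ i → first i * q ≤ r (J i) + p′
  first-upper i = m/n*n≤m (r (J i) + p′) q

  deadline-upper : ∀ i → deadline i * q ≤ d (J i)
  deadline-upper i = m/n*n≤m (d (J i)) q

  deadline-lower : ∀ i → d (J i) < suc (deadline i) * q
  deadline-lower i = begin-strict
    d (J i)                             ≡⟨ m≡m%n+[m/n]*n (d (J i)) q ⟩
    d (J i) % q + deadline i * q        <⟨ +-monoˡ-< _ (m%n<n (d (J i)) q) ⟩
    q + deadline i * q                  ∎
    where open ≤-Reasoning hiding (start)

  -- The two roundings lose less than `q` each, so more than `q` of the length `3 * q` remains. What
  -- remains is a multiple of `q`, hence at least `2 * q`.
  first+2≤deadline : ∀ {i} → Loose i → first i + 2 ≤ deadline i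
  first+2≤deadline {i} l = subst (_≤ deadline i) (+-comm 2 (first i)) (ℕ.s≤s⁻¹ (*-cancelʳ-< q _ _ (begin-strict
    (2 + first i) * q          ≡⟨ *-distribʳ-+ q 2 (first i) ⟩
    2 * q + first i * q        ≤⟨ +-monoʳ-≤ (2 * q) (first-upper i) ⟩
    2 * q + (r (J i) + p′)     <⟨ +-monoʳ-< (2 * q) (+-monoʳ-< (r (J i)) ≤-refl) ⟩
    2 * q + (r (J i) + q)      ≡⟨ arith q (r (J i)) ⟩
    r (J i) + 3 * q            ≤⟨ l ⟩
    d (J i)                    <⟨ deadline-lower i ⟩
    suc (deadline i) * q       ∎)))
    where
    open ≤-Reasoning hiding (start)
    arith : ∀ q x → 2 * q + (x + q) ≡ x + 3 * q
    arith = solve-∀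

-- Earliest deadline first with a growing capacity

module EDF (p′ : ℕ) (J : ℕ → Job) (n : ℕ) where

  open Classes p′ J

  Arrived : ℕ → Pred ℕ 0ℓ
  Arrived k i = Loose i × first i ≤ k

  arrived? : ∀ k → Decidable (Arrived k)
  arrived? k i = loose? i ×-dec (first i ≤? k)

  -- jobs known in slot k whose admissible slots lie in [k+u-X, k+u)
  Inside : ℕ → ℕ → ℕ → Pred ℕ 0ℓ
  Inside k X u i = Arrived k i × deadline i ≤ k + u × k + u ≤ first i + X

  inside? : ∀ k X u → Decidable (Inside k X u)
  inside? k X u i = arrived? k i ×-dec (deadline i ≤? k + u) ×-dec (k + u ≤? first i + X)

  -- The least `g` such that the count is below `g * (2 + X)`. The 2 extends the `X` slots by one on
  -- either side. A strict inequality is right because a deadline lies strictly before the end of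
  -- the slot into which it was rounded.
  density : ℕ → ℕ → ℕ → ℕ
  density k X u = suc (cnt (inside? k X u) n / (2 + X))

  densest : ℕ → ℕ → ℕ
  densest k X = maxBelow (density k X) (suc X)

  -- A finite search over `X` suffices: if `X` exceeds the number of arrived jobs, the count is
  -- below `2 + X` and the density is 1.
  guess : ℕ → ℕ
  guess k = maxBelow (densest k) (suc (cnt (arrived? k) n))

  guess≥1 : ∀ k → 1 ≤ guess k
  guess≥1 k = ≤-trans (s≤s z≤n) (≤-trans (maxBelow-upper (density k 0) 1 {0} ≤-refl)
    (maxBelow-upper (densest k) (suc (cnt (arrived? k) n)) {0} (s≤s z≤n)))

  inside<guess : ∀ k {X u} → u ≤ X → cnt (inside? k X u) n < guess k * (2 + X)
  inside<guess k {X} {u} u≤X with X ≤? cnt (arrived? k) n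
  ... | yes X≤N = begin-strict
    c                                   ≡⟨ m≡m%n+[m/n]*n c (2 + X) ⟩
    c % (2 + X) + c / (2 + X) * (2 + X) <⟨ +-monoˡ-< _ (m%n<n c (2 + X)) ⟩
    density k X u * (2 + X)             ≤⟨ *-monoˡ-≤ (2 + X) (≤-trans
        (maxBelow-upper (density k X) (suc X) (s≤s u≤X))
                                             (maxBelow-upper (densest k) (suc (cnt (arrived? k) n)) (s≤s X≤N))) ⟩
    guess k * (2 + X)                   ∎
    where
    open ≤-Reasoning hiding (start)
    c = cnt (inside? k X u) n
  ... | no X≰N = begin-strict
    cnt (inside? k X u) n   ≤⟨ cnt-mono (inside? k X u) (arrived? k) n (λ _ _ → proj₁) ⟩
    cnt (arrived? k) n      <⟨ ≰⇒> X≰N ⟩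
    X                       ≤⟨ m≤n+m X 2 ⟩
    2 + X                   ≡⟨ *-identityˡ (2 + X) ⟨
    1 * (2 + X)             ≤⟨ *-monoˡ-≤ (2 + X) (guess≥1 k) ⟩
    guess k * (2 + X)       ∎
    where open ≤-Reasoning hiding (start)

  guess-least : ∀ k {m} → (∀ X u → cnt (inside? k X u) n < m * (2 + X)) → guess k ≤ m
  guess-least k h = maxBelow-least (densest k) (suc (cnt (arrived? k) n))
      (λ X _ → maxBelow-least (density k X) (suc X) (λ u _ → m<n*o⇒m/o<n (h X u)))

  capacity : ℕ → ℕ
  capacity k = guess k * 5

  Pending : ℕ → Placement → Pred ℕ 0ℓ
  Pending k f i = Arrived k i × f i ≡ nothing

  pending? : ∀ k f → Decidable (Pending k f)
  pending? k f i = arrived? k i ×-dec nothing? (f i)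

  urgent : ℕ → Placement → Maybe ℕ
  urgent k f = argmin (pending? k f) deadline n

  fill : ℕ → ℕ → Placement → Placement
  fill k zero    f = f
  fill k (suc c) f = place (urgent k (fill k c f)) (k , c) (fill k c f)

  edf : ℕ → Placement
  edf zero    = λ _ → nothing
  edf (suc k) = fill k (capacity k) (edf k)

  -- The lower bound on the slots of new entries serves `Later-early`: what happens in slots before
  -- `k` can be read off `f`, which is needed for non-anticipation.
  Later : ℕ → Placement → Placement → Set
  Later k f g = ∀ i → g i ≡ f i ⊎ (f i ≡ nothing × ∃ λ k′ → ∃ λ c → k ≤ k′ × g i ≡ just (k′ , c))

  Later-trans : ∀ {k k′ f g h} → k ≤ k′ → Later k f g → Later k′ g h → Later k f h
  Later-trans k≤ fg gh i with fg i | gh i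
  ... | inj₁ e           | inj₁ e′ = inj₁ (trans e′ e)
  ... | inj₁ e           | inj₂ (z , k″ , c , le , e′) = inj₂ (trans (sym e) z , k″ , c , ≤-trans k≤ le , e′)
  ... | inj₂ (z , k″ , c , le , e) | inj₁ e′ = inj₂ (z , k″ , c , le , trans e′ e)
  ... | inj₂ (z , k″ , c , le , e) | inj₂ (z′ , _) = contradiction (trans (sym e) z′) λ ()

  place-Later : ∀ k c f → Later k f (place (urgent k f) (k , c) f)
  place-Later k c f i with urgent k f in e
  ... | nothing = inj₁ refl
  ... | just j with i ℕₚ.≟ j
  ...   | no _     = inj₁ refl
  ...   | yes refl = inj₂ (proj₂ (proj₁ (proj₂ (argmin-just (pending? k f) deadline n e))) , k , c , ≤-refl , refl)

  fill-Later : ∀ k c f → Later k f (fill k c f)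
  fill-Later k zero    f = λ _ → inj₁ refl
  fill-Later k (suc c) f = Later-trans ≤-refl (fill-Later k c f) (place-Later k c (fill k c f))

  edf-Later : ∀ k e → Later k (edf k) (edf (e + k))
  edf-Later k zero    = λ _ → inj₁ refl
  edf-Later k (suc e) =
      Later-trans (m≤n+m k e) (edf-Later k e) (fill-Later (e + k) (capacity (e + k)) (edf (e + k)))

  edf-Later-≤ : ∀ {k k′} → k ≤ k′ → Later k (edf k) (edf k′)
  edf-Later-≤ {k} {k′} k≤k′ = subst (λ x → Later k (edf k) (edf x)) (m∸n+n≡m k≤k′) (edf-Later k (k′ ∸ k))

  Later-just : ∀ {k f g i v} → Later k f g → f i ≡ just v → g i ≡ just v
  Later-just {i = i} l e with l i
  ... | inj₁ e′      = trans e′ e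
  ... | inj₂ (z , _) = contradiction (trans (sym e) z) λ ()

  Later-nothing : ∀ {k f g i} → Later k f g → g i ≡ nothing → f i ≡ nothing
  Later-nothing {i = i} l e with l i
  ... | inj₁ e′      = trans (sym e′) e
  ... | inj₂ (z , _) = z

  Later-early : ∀ {k f g i k′ c} → Later k f g → g i ≡ just (k′ , c) → k′ < k → f i ≡ just (k′ , c)
  Later-early {i = i} l e lt with l i
  ... | inj₁ e′ = trans (sym e′) e
  ... | inj₂ (_ , k″ , c , le , e′) with trans (sym e) e′
  ...   | refl = contradiction le (<⇒≱ lt)

  -- Occupied positions precede `(k , c)` lexicographically. So the next position to be given away,
  -- `(k , c)`, is free, and `inj` survives.
  record Good (k c : ℕ) (f : Placement) : Set where
    field
      sound : ∀ {i k′ c′} → f i ≡ just (k′ , c′) →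
              i < n × Arrived k′ i × c′ < capacity k′ × (k′ < k ⊎ (k′ ≡ k × c′ < c))
      inj   : ∀ {i j v} → f i ≡ just v → f j ≡ just v → i ≡ j
  open Good public

  Good-place : ∀ {k c f} → c < capacity k → Good k c f → Good k (suc c) (place (urgent k f) (k , c) f)
  Good-place {k} {c} {f} c< G with urgent k f in e
  ... | nothing = record
    { sound =
        λ eq → let (a , b , x , y) = sound G eq in a , b , x , [ inj₁ , (λ (u , v) → inj₂ (u , m≤n⇒m≤1+n v)) ]′ y
    ; inj   = inj G }
  ... | just j = record { sound = sound′ ; inj = inj′ }
    where
    am = argmin-just (pending? k f) deadline n e
    new : ∀ {i} → f i ≢ just (k , c)
    new eq with sound G eq
    ... | (_ , _ , _ , inj₁ lt)       = <-irrefl refl lt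
    ... | (_ , _ , _ , inj₂ (_ , lt)) = <-irrefl refl lt
    sound′ : ∀ {i k′ c′} → place (just j) (k , c) f i ≡ just (k′ , c′) →
              i < n × Arrived k′ i × c′ < capacity k′ × (k′ < k ⊎ (k′ ≡ k × c′ < suc c))
    sound′ {i} eq with i ℕₚ.≟ j
    sound′ {i} refl | yes refl = proj₁ am , proj₁ (proj₁ (proj₂ am)) , c< , inj₂ (refl , ≤-refl)
    ... | no _ = let (a , b , x , y) = sound G eq in a , b , x , [ inj₁ , (λ (u , v) → inj₂ (u , m≤n⇒m≤1+n v)) ]′ y
    inj′ : ∀ {i i′ v} → place (just j) (k , c) f i ≡ just v → place (just j) (k , c) f i′ ≡ just v → i ≡ i′
    inj′ {i} {i′} x y with i ℕₚ.≟ j | i′ ℕₚ.≟ j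
    ... | yes refl | yes refl = refl
    ... | yes refl | no _     = contradiction (trans y (sym x)) new
    ... | no _     | yes refl = contradiction (trans x (sym y)) new
    ... | no _     | no _     = inj G x y

  Good-fill : ∀ {k f} c → c ≤ capacity k → Good k 0 f → Good k c (fill k c f)
  Good-fill zero    _  G = G
  Good-fill (suc c) c< G = Good-place c< (Good-fill c (<⇒≤ c<) G)

  Good-edf : ∀ k → Good k 0 (edf k)
  Good-edf zero = record { sound = λ () ; inj = λ () }
  Good-edf (suc k) = record
    { sound = λ eq → let (a , b , x , y) = sound G eq in a , b , x , inj₁
        (s≤s ([ <⇒≤ , (λ (u , _) → ≤-reflexive u) ]′ y))
    ; inj   = inj G }
    where G = Good-fill (capacity k) ≤-refl (Good-edf k)

  -- No deadline is missed

  module _ (D : ℕ) where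

    Due : Pred ℕ 0ℓ
    Due i = Loose i × deadline i ≤ D

    DueFrom : ℕ → Pred ℕ 0ℓ
    DueFrom s i = Due i × s ≤ first i

    dueFrom? : ∀ s → Decidable (DueFrom s)
    dueFrom? s i = (loose? i ×-dec (deadline i ≤? D)) ×-dec (s ≤? first i)

    Done : ℕ → Placement → Pred ℕ 0ℓ
    Done s f i = DueFrom s i × f i ≢ nothing

    done? : ∀ s f → Decidable (Done s f)
    done? s f i = dueFrom? s i ×-dec ¬? (nothing? (f i))

    done# : ℕ → Placement → ℕ
    done# s f = cnt (done? s f) n

    Fresh : ℕ → Placement → Set
    Fresh s f = ∀ i → i < n → Due i → f i ≡ nothing → s ≤ first i

    Exhausted : ℕ → Placement → Set
    Exhausted k f = ∀ i → i < n → Due i → Arrived k i → f i ≢ nothing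

    -- This is where the earliest-deadline rule enters: if the chosen job is not due by `D`, then no
    -- pending job is. Otherwise a due job gets placed, and `Fresh` puts it among those counted from
    -- `s`.
    place-progress : ∀ k c s f → Fresh s f →
      let g = place (urgent k f) (k , c) f in Exhausted k g ⊎ suc (done# s f) ≤ done# s g
    place-progress k c s f fresh with urgent k f in e | place-Later k c f
    ... | nothing | _ = inj₁ (λ i i<n q a z → argmin-nothing (pending? k f) deadline n e i i<n (a , z))
    ... | just j | later with argmin-just (pending? k f) deadline n e | deadline j ≤? D
    ...   | (_ , _ , min) | no ¬due =
      inj₁ (λ i i<n q a z → ¬due (≤-trans (min i i<n (a , Later-nothing later z)) (proj₂ q)))
    ...   | (j<n , ((l , _) , z) , _) | yes due =
        inj₂ (cnt-strict (done? s f) (done? s (place (just j) (k , c) f)) n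
      (λ i _ (q , ne) → q , (λ z′ → ne (Later-nothing later z′))) j<n
      (((l , due) , fresh j j<n (l , due) z) , placed) (λ (_ , ne) → ne z))
      where
      placed : place (just j) (k , c) f j ≢ nothing
      placed eq with j ℕₚ.≟ j
      placed () | yes _
      ... | no ne = ne refl

    fill-progress : ∀ k s f → Fresh s f → ∀ c →
      Exhausted k (fill k c f) ⊎ c + done# s f ≤ done# s (fill k c f)
    fill-progress k s f fresh zero = inj₂ ≤-refl
    fill-progress k s f fresh (suc c) with fill-progress k s f fresh c
    ... | inj₁ none = inj₁ (λ i i<n q a e → none i i<n q a (Later-nothing (place-Later k c (fill k c f)) e))
    ... | inj₂ ih with place-progress k c s (fill k c f)
        (λ i i<n q e → fresh i i<n q (Later-nothing (fill-Later k c f) e))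
    ...   | inj₁ none = inj₁ none
    ...   | inj₂ up   = inj₂ (≤-trans (s≤s ih) up)

    -- The slots from `s` up to `k` form a busy period: each was filled to capacity with due jobs,
    -- and due jobs still waiting became admissible at `s` or later. A slot that exhausts the
    -- arrived due jobs ends the period, and a new empty one begins behind it.
    busy : ∀ k → ∃ λ s → ∃ λ e → s + e ≡ k × Fresh s (edf k) ×
           sumBelow (λ v → capacity (s + v)) e ≤ done# s (edf k)
    busy zero = 0 , 0 , refl , (λ _ _ _ _ → z≤n) , z≤n
    busy (suc k) with busy k
    ... | (s , e , eq , fresh , le) with fill-progress k s (edf k) fresh (capacity k)
    ...   | inj₁ none = suc k , 0 , +-identityʳ (suc k) , fresh′ , z≤n
      where
      fresh′ : Fresh (suc k) (edf (suc k))
      fresh′ i i<n q z with first i ≤? k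
      ... | yes arr = contradiction z (none i i<n q (proj₁ q , arr))
      ... | no ¬arr = ≰⇒> ¬arr
    ...   | inj₂ up = s , suc e , trans (+-suc s e) (cong suc eq) ,
      (λ i i<n q z → fresh i i<n q (Later-nothing (fill-Later k (capacity k) (edf k)) z)) , (begin
        sumBelow (λ v → capacity (s + v)) e + capacity (s + e)
            ≡⟨ cong (λ x → sumBelow (λ v → capacity (s + v)) e + capacity x) eq ⟩
        sumBelow (λ v → capacity (s + v)) e + capacity k        ≤⟨ +-monoˡ-≤ (capacity k) le ⟩
        done# s (edf k) + capacity k                            ≡⟨ +-comm _ (capacity k) ⟩
        capacity k + done# s (edf k)                            ≤⟨ up ⟩
        done# s (edf (suc k))                                   ∎)
      where open ≤-Reasoning hiding (start)

    -- index 0 is D itself, which is too late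
    before : ℕ → ℕ
    before zero    = 0
    before (suc u) = capacity (D ∸ suc u)

    sum-before : ∀ e {s} → s + e ≡ D → sumBelow before (suc e) ≡ sumBelow (λ v → capacity (s + v)) e
    sum-before zero    _  = refl
    sum-before (suc e) {s} eq = begin
      sumBelow before (suc e) + capacity (D ∸ suc e)
        ≡⟨ cong₂ _+_ (sum-before e (trans (sym (+-suc s e)) eq))
            (cong capacity (trans (cong (_∸ suc e) (sym eq)) (m+n∸n≡m s (suc e)))) ⟩
      sumBelow (λ v → capacity (suc s + v)) e + capacity s
        ≡⟨ +-comm _ (capacity s) ⟩
      capacity s + sumBelow (λ v → capacity (suc s + v)) e
        ≡⟨ cong₂ _+_ (cong capacity (sym (+-identityʳ s))) (sumBelow-cong e
            (λ v _ → cong capacity (sym (+-suc s v)))) ⟩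
      sumBelow (λ v → capacity (s + v)) 1 + sumBelow (λ v → capacity (s + suc v)) e
        ≡⟨ sumBelow-+ (λ v → capacity (s + v)) 1 e ⟨
      sumBelow (λ v → capacity (s + v)) (suc e) ∎
      where open ≡-Reasoning

    -- Call `D - first i` the distance of job `i`. `Near` bounds it by `x` and `Block` puts it
    -- between `2 * b` and `4 * b`, both written as sums because subtraction truncates.
    Near : ℕ → ℕ → Pred ℕ 0ℓ
    Near s x i = DueFrom s i × D < first i + x

    near? : ∀ s x → Decidable (Near s x)
    near? s x i = dueFrom? s i ×-dec (D <? first i + x)

    Block : ℕ → ℕ → Pred ℕ 0ℓ
    Block s b i = DueFrom s i × first i + 2 * b ≤ D × D < first i + 4 * b

    block? : ∀ s b → Decidable (Block s b)
    block? s b i = dueFrom? s i ×-dec (first i + 2 * b ≤? D) ×-dec (D <? first i + 4 * b)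

    -- All jobs of the block have arrived by each of the slots at distance `b + v < 2 * b`, so
    -- `guess` accounts for the whole block in each of these `b` slots. Each has capacity for a
    -- `1 / b` share of it.
    block-capacity : ∀ s b → 1 ≤ b → 2 * b ≤ suc D → cnt (block? s b) n ≤ sumBelow (λ v → before (b + v)) b
    block-capacity s b@(suc b′) 1≤b 2b≤ = *-cancelˡ-≤ b (sumBelow-lower (λ v → before (b + v)) {b} b slot)
      where
      open ≤-Reasoning hiding (start)
      -- `X` is `4 * b - 1`, the largest distance in the block.
      X = 3 + 4 * b′
      1+X≡4b : ∀ b → 1 + (3 + 4 * b) ≡ 4 * suc b
      1+X≡4b = solve-∀
      slot : ∀ v → v < b → cnt (block? s b) n ≤ b * before (b + v)
      slot v v<b = begin
        cnt (block? s b) n                   ≤⟨ cnt-mono (block? s b) (inside? k X u) n inside ⟩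
        cnt (inside? k X u) n                ≤⟨ <⇒≤ (inside<guess k u≤X) ⟩
        guess k * (2 + X)                    ≤⟨ *-monoʳ-≤ (guess k) 2+X≤ ⟩
        guess k * (5 * b)                    ≡⟨ arith (guess k) b ⟩
        b * capacity k                       ∎
        where
        u = b + v
        k = D ∸ u
        u<2b : u < 2 * b
        u<2b = subst (u <_) (cong (b +_) (sym (+-identityʳ b))) (+-monoʳ-< b v<b)
        u≤D : u ≤ D
        u≤D = ℕ.s≤s⁻¹ (≤-trans u<2b 2b≤)
        k+u : k + u ≡ D
        k+u = m∸n+n≡m u≤D
        u≤X : u ≤ X
        u≤X = ℕ.s≤s⁻¹ (≤-trans u<2b (subst (2 * b ≤_) (sym (1+X≡4b b′)) (*-monoˡ-≤ b {2} {4} (s≤s (s≤s z≤n)))))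
        -- The requirement `4 * b + 1 ≤ 5 * b` determines the factor 5 in `capacity`; it is tight
        -- for `b = 1`.
        2+X≤ : 2 + X ≤ 5 * b
        2+X≤ = begin
          2 + X         ≡⟨ cong suc (1+X≡4b b′) ⟩
          1 + 4 * b     ≤⟨ +-monoˡ-≤ (4 * b) 1≤b ⟩
          5 * b         ∎
        arith : ∀ g b → g * (5 * b) ≡ b * (g * 5)
        arith = solve-∀
        inside : ∀ i → i < n → Block s b i → Inside k X u i
        inside i _ (((l , dl) , _) , far , near) =
          (l , +-cancelʳ-≤ u _ _ (begin
            first i + u        ≤⟨ +-monoʳ-≤ (first i) (<⇒≤ u<2b) ⟩
            first i + 2 * b    ≤⟨ far ⟩
            D                  ≡⟨ k+u ⟨
            k + u              ∎)) ,
          ≤-trans dl (≤-reflexive (sym k+u)) ,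
          ≤-trans (≤-reflexive k+u) (ℕ.s≤s⁻¹ (≤-trans near (≤-reflexive
              (trans (cong (first i +_) (sym (1+X≡4b b′))) (+-suc (first i) X)))))

    -- With `b = 2 ^ j`, jobs at distance below `2 * b` are charged to slots at distance below `b`.
    -- Doubling `b` adds one block of jobs together with the slots that pay for it. No job counted
    -- from `s` is farther than `e` from `D`, so the doubling covers all of them before it runs out
    -- of slots.
    hall : ∀ s e → s + e ≡ D → cnt (dueFrom? s) n ≤ sumBelow before (suc e)
    hall s e eq = finish (dyadic (suc e))
      where
      open ≤-Reasoning hiding (start)
      Goal : ℕ → Set
      Goal j = (2 ^ j ≤ suc e × cnt (near? s (2 * 2 ^ j)) n ≤ sumBelow before (2 ^ j))
             ⊎ cnt (dueFrom? s) n ≤ sumBelow before (suc e)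
      dyadic : ∀ j → Goal j
      -- A loose job due by `D` has distance at least 2, so there is nothing to charge to index 0.
      dyadic zero = inj₁ (s≤s z≤n , ≤-reflexive (cnt-none (near? s 2) n
        (λ i _ (((l , dl) , _) , lt) → <⇒≱ lt (≤-trans (first+2≤deadline l) dl))))
      dyadic (suc j) with dyadic j
      ... | inj₂ done = inj₂ done
      ... | inj₁ (b≤ , le) with 2 ^ suc j ≤? suc e
      ...   | no 2b≰ = inj₂ (begin
        cnt (dueFrom? s) n               ≤⟨ cnt-mono (dueFrom? s) (near? s (2 * 2 ^ j)) n near ⟩
        cnt (near? s (2 * 2 ^ j)) n      ≤⟨ le ⟩
        sumBelow before (2 ^ j)          ≤⟨ sumBelow-monoʳ before b≤ ⟩
        sumBelow before (suc e)          ∎)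
        where
        near : ∀ i → i < n → DueFrom s i → Near s (2 * 2 ^ j) i
        near i _ q@(_ , s≤) = q , (begin-strict
          D                        ≡⟨ eq ⟨
          s + e                    <⟨ +-mono-≤-< s≤ (<-trans ≤-refl (≰⇒> 2b≰)) ⟩
          first i + 2 * 2 ^ j      ∎)
      ...   | yes 2b≤ = inj₁ (2b≤ , (begin
        cnt (near? s (2 * (2 * b))) n
          ≤⟨ cnt-cover (near? s (2 * (2 * b))) (near? s (2 * b)) (block? s b) n split ⟩
        cnt (near? s (2 * b)) n + cnt (block? s b) n
          ≤⟨ +-mono-≤ le (block-capacity s b (m^n>0 2 j) (≤-trans 2b≤
              (s≤s (≤-trans (m≤n+m e s) (≤-reflexive eq))))) ⟩
        sumBelow before b + sumBelow (λ v → before (b + v)) b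
          ≡⟨ sumBelow-+ before b b ⟨
        sumBelow before (b + b)
          ≡⟨ cong (λ x → sumBelow before (b + x)) (+-identityʳ b) ⟨
        sumBelow before (2 * b) ∎))
        where
        b = 2 ^ j
        split : ∀ i → i < n → Near s (2 * (2 * b)) i → Near s (2 * b) i ⊎ Block s b i
        split i _ (q , lt) with D <? first i + 2 * b
        ... | yes near = inj₁ (q , near)
        ... | no far   = inj₂ (q , ≮⇒≥ far , subst (λ x → D < first i + x) (sym (*-assoc 2 2 b)) lt)
      -- After `suc e` doublings `2 ^ j` exceeds `suc e`, which leaves only the second alternative.
      finish : Goal (suc e) → cnt (dueFrom? s) n ≤ sumBelow before (suc e)
      finish (inj₂ done)     = done
      finish (inj₁ (le , _)) = contradiction le (<⇒≱ (n<2^n (suc e)))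
        where
        n<2^n : ∀ x → x < 2 ^ x
        n<2^n zero    = s≤s z≤n
        n<2^n (suc x) = +-mono-≤ {1} (m^n>0 2 x) (≤-trans (n<2^n x) (m≤m+n _ 0))

  -- A job unplaced at its deadline would come on top of due jobs that already fill the busy period,
  -- one more than `hall` permits.
  edf-meets-deadlines : ∀ {i} → i < n → Loose i → ∃ λ v → edf (deadline i) i ≡ just v
  edf-meets-deadlines {i} i<n l with edf (deadline i) i in z
  ... | just v = v , refl
  ... | nothing with busy (deadline i) (deadline i)
  ...   | (s , e , eq , fresh , le) = contradiction (begin-strict
    sumBelow (λ v → capacity (s + v)) e             ≤⟨ le ⟩
    done# (deadline i) s (edf (deadline i))         <⟨ cnt-strict (done? (deadline i) s (edf (deadline i)))
        (dueFrom? (deadline i) s) n (λ _ _ → proj₁)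
        i<n ((l , ≤-refl) , fresh i i<n (l , ≤-refl) z) (λ (_ , ne) → ne z) ⟩
    cnt (dueFrom? (deadline i) s) n                 ≤⟨ hall (deadline i) s e eq ⟩
    sumBelow (before (deadline i)) (suc e)          ≡⟨ sum-before (deadline i) e eq ⟩
    sumBelow (λ v → capacity (s + v)) e             ∎) (<-irrefl refl)
    where open ≤-Reasoning hiding (start)

-- Greedy colouring of the tight jobs

module Colouring (p′ : ℕ) (J : ℕ → Job) where

  open Classes p′ J

  Conflict : ℕ → Pred ℕ 0ℓ
  Conflict j i = ¬ Loose i × r (J j) < r (J i) + q

  conflict? : ∀ j → Decidable (Conflict j)
  conflict? j i = ¬? (loose? i) ×-dec (r (J j) <? r (J i) + q)

  Used : ℕ → (ℕ → ℕ) → Pred ℕ 0ℓ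
  Used j f c = ∃ λ i → i < j × Conflict j i × f i ≡ c

  used? : ∀ j f → Decidable (Used j f)
  used? j f c = anyUpTo? (λ i → conflict? j i ×-dec (f i ℕₚ.≟ c)) j

  nextColour : ℕ → (ℕ → ℕ) → ℕ
  nextColour j f = mex (used? j f) (suc j)

  -- The greedy choice refers to all earlier colours, so the recursion carries their whole table; 0
  -- stands for jobs not coloured yet.
  colours : ℕ → ℕ → ℕ
  colours zero    i = 0
  colours (suc j) i with i ℕₚ.≟ j
  ... | yes _ = nextColour j (colours j)
  ... | no  _ = colours j i

  colour : ℕ → ℕ
  colour j = nextColour j (colours j)

  colours-stable : ∀ k {i} → i < k → colours k i ≡ colour i
  colours-stable (suc k) {i} i<k with i ℕₚ.≟ k
  ... | yes refl = refl
  ... | no ne    = colours-stable k (≤∧≢⇒< (ℕ.s≤s⁻¹ i<k) ne)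

  -- `mex` passes over a colour only if an earlier conflicting job has it, so each smaller colour
  -- accounts for a different conflict.
  colour-bound : ∀ j → colour j ≤ cnt (conflict? j) j
  colour-bound j =
      pigeonhole (conflict? j) (colours j) (colour j) j (λ c lt → mex-below (used? j (colours j)) (suc j) lt)

  colour-proper : ∀ {i j} → i < j → Conflict j i → colour i ≢ colour j
  colour-proper {i} {j} i<j conf eq with mex-spec (used? j (colours j)) (suc j)
  ... | inj₁ unused = unused (i , i<j , conf , trans (colours-stable j i<j) eq)
  -- The search cannot pass all `suc j` colours, since the `j` earlier jobs occupy at most `j` of
  -- them.
  ... | inj₂ full   = contradiction (≤-trans (≤-reflexive (sym full))
      (≤-trans (colour-bound j) (cnt-≤ (conflict? j) j))) (<⇒≱ ≤-refl)

-- Decisions depend only on the jobs already released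

module ColouringAgree (p′ : ℕ) (J J′ : ℕ → Job) (b : ℕ) (agree : ∀ i → i < b → J i ≡ J′ i) where
  private
    module A = Colouring p′ J
    module B = Colouring p′ J′

  conflict-agree : ∀ {i j} → i < b → j < b → A.Conflict j i → B.Conflict j i
  conflict-agree i<b j<b =
      subst₂ (λ x y → ¬ (r x + 3 * suc p′ ≤ d x) × r y < r x + suc p′) (agree _ i<b) (agree _ j<b)

  conflict-agree′ : ∀ {i j} → i < b → j < b → B.Conflict j i → A.Conflict j i
  conflict-agree′ i<b j<b =
      subst₂ (λ x y → ¬ (r x + 3 * suc p′ ≤ d x) × r y < r x + suc p′) (sym (agree _ i<b)) (sym (agree _ j<b))

  nextColour-agree : ∀ {j f g} → j < b → (∀ i → f i ≡ g i) → A.nextColour j f ≡ B.nextColour j g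
  nextColour-agree {j} {f} {g} j<b h = mex-cong (A.used? j f) (B.used? j g)
    (λ c (i , i<j , conf , e) → i , i<j , conflict-agree (<-trans i<j j<b) j<b conf , trans (sym (h i)) e)
    (λ c (i , i<j , conf , e) → i , i<j , conflict-agree′ (<-trans i<j j<b) j<b conf , trans (h i) e) (suc j)

  colours-agree : ∀ k → k ≤ b → ∀ i → A.colours k i ≡ B.colours k i
  colours-agree zero    _   i = refl
  colours-agree (suc k) k<b i with i ℕₚ.≟ k
  ... | yes _ = nextColour-agree k<b (colours-agree k (<⇒≤ k<b))
  ... | no  _ = colours-agree k (<⇒≤ k<b) i

  colour-agree : ∀ {j} → j < b → A.colour j ≡ B.colour j
  colour-agree {j} j<b = nextColour-agree j<b (colours-agree j (<⇒≤ j<b))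

module EDFAgree (p′ : ℕ) (J J′ : ℕ → Job) {n n′ b t : ℕ} (b≤n : b ≤ n) (b≤n′ : b ≤ n′)
  (agree : ∀ i → i < b → J i ≡ J′ i)
  (late  : ∀ i → b ≤ i → i < n → t ≤ r (J i))
  (late′ : ∀ i → b ≤ i → i < n′ → t ≤ r (J′ i)) where

  private
    q = suc p′
    module A = EDF p′ J n
    module B = EDF p′ J′ n′

  module _ {k : ℕ} (kq<t : k * q < t) where

    -- Having arrived by slot `k` would mean a release no later than `k * q`, which is before `t`.
    arrived-late : ∀ i → b ≤ i → i < n → ¬ A.Arrived k i
    arrived-late i b≤i i<n (_ , le) =
        <⇒≱ kq<t (≤-trans (late i b≤i i<n) (≤-trans (Classes.first-lower p′ J i) (*-monoˡ-≤ q le)))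

    arrived-late′ : ∀ i → b ≤ i → i < n′ → ¬ B.Arrived k i
    arrived-late′ i b≤i i<n (_ , le) =
        <⇒≱ kq<t (≤-trans (late′ i b≤i i<n) (≤-trans (Classes.first-lower p′ J′ i) (*-monoˡ-≤ q le)))

    -- Both sides are the same expression in the job, so they are equal as types and `subst id`
    -- transports either way.
    arrived-agree : ∀ i → i < b → A.Arrived k i ≡ B.Arrived k i
    arrived-agree i i<b = cong (λ x → (r x + 3 * q ≤ d x) × (r x + p′) / q ≤ k) (agree i i<b)

    inside-agree : ∀ X u i → i < b → A.Inside k X u i ≡ B.Inside k X u i
    inside-agree X u i i<b = cong (λ x → ((r x + 3 * q ≤ d x) × (r x + p′) / q ≤ k) ×
        d x / q ≤ k + u × k + u ≤ (r x + p′) / q + X) (agree i i<b)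

    density-agree : ∀ X u → A.density k X u ≡ B.density k X u
    density-agree X u = cong (λ c → suc (c / (2 + X))) (cnt-agree (A.inside? k X u) (B.inside? k X u) b≤n b≤n′
      (λ i b≤i i<n → arrived-late i b≤i i<n ∘ proj₁) (λ i b≤i i<n → arrived-late′ i b≤i i<n ∘ proj₁)
      (λ i i<b → subst id (inside-agree X u i i<b)) (λ i i<b → subst id (sym (inside-agree X u i i<b))))

    guess-agree : A.guess k ≡ B.guess k
    guess-agree = trans (maxBelow-cong {A.densest k} {B.densest k} (suc (cnt (A.arrived? k) n))
        (λ X → maxBelow-cong {A.density k X} (suc X) (density-agree X)))
      (cong (λ c → maxBelow (B.densest k) (suc c)) (cnt-agree (A.arrived? k)
          (B.arrived? k) b≤n b≤n′ arrived-late arrived-late′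
        (λ i i<b → subst id (arrived-agree i i<b)) (λ i i<b → subst id (sym (arrived-agree i i<b)))))

    urgent-agree : ∀ {f g} → (∀ i → f i ≡ g i) → A.urgent k f ≡ B.urgent k g
    urgent-agree {f} {g} h = argmin-agree (A.pending? k f) (B.pending? k g) _ _ b≤n b≤n′
      (λ i b≤i i<n → arrived-late i b≤i i<n ∘ proj₁) (λ i b≤i i<n → arrived-late′ i b≤i i<n ∘ proj₁)
      (λ i i<b (a , e) → subst id (arrived-agree i i<b) a , trans (sym (h i)) e)
      (λ i i<b (a , e) → subst id (sym (arrived-agree i i<b)) a , trans (h i) e)
      (λ i i<b → cong (λ x → d x / q) (agree i i<b))

    fill-agree : ∀ c {f g} → (∀ i → f i ≡ g i) → ∀ i → A.fill k c f i ≡ B.fill k c g i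
    fill-agree zero    h i = h i
    fill-agree (suc c) {f} {g} h i = trans
      (cong (λ x → place x (k , c) (A.fill k c f) i) (urgent-agree (fill-agree c h)))
      (place-cong (B.urgent k (B.fill k c g)) (k , c) (fill-agree c h) i)

  edf-agree : ∀ k → (∀ k′ → k′ < k → k′ * q < t) → ∀ i → A.edf k i ≡ B.edf k i
  edf-agree zero    h i = refl
  edf-agree (suc k) h i = trans
    (fill-agree (h k ≤-refl) (A.capacity k) (edf-agree k (λ k′ lt → h k′ (m≤n⇒m≤1+n lt))) i)
    (cong (λ c → B.fill k (c * 5) (B.edf k) i) (guess-agree (h k ≤-refl)))

  -- An entry in slot `k` is already present at stage `suc k`. That stage involves only slots
  -- beginning before `t`, so it agrees in both instances, and the entry persists up to `D`.
  early-slot-agree : ∀ {D i k c} → k * q < t → A.edf D i ≡ just (k , c) → B.edf D i ≡ just (k , c)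
  early-slot-agree {D} {i} {k} {c} kq<t e = B.Later-just (B.edf-Later-≤ k<D)
    (trans (sym (edf-agree (suc k) (λ k′ lt → ≤-<-trans (*-monoˡ-≤ q (ℕ.s≤s⁻¹ lt)) kq<t) i))
           (A.Later-early (A.edf-Later-≤ k<D) e ≤-refl))
    where
    k<D : suc k ≤ D
    k<D with A.Good.sound (A.Good-edf D) e
    ... | (_ , _ , _ , inj₁ lt) = lt

-- Numbering of the machines

-- The number of machines is not known in advance, so tight and loose jobs share them by residues
-- modulo 9: 0–3 for tight jobs and 4–8 for loose ones.
tightMachine looseMachine : ℕ → ℕ
tightMachine c = c % 4 + (c / 4) * 9
looseMachine c = (4 + c % 5) + (c / 5) * 9

private
  mixed-radix : ∀ {x y} a b → x < 9 → y < 9 → x + a * 9 ≡ y + b * 9 → x ≡ y × a ≡ b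
  mixed-radix {x} {y} a b x<9 y<9 e =
      x≡y , *-cancelʳ-≡ a b 9 (+-cancelˡ-≡ x _ _ (trans e (cong (_+ b * 9) (sym x≡y))))
    where
    x≡y : x ≡ y
    x≡y = trans (sym (trans ([m+kn]%n≡m%n x a 9) (m<n⇒m%n≡m x<9)))
            (trans (cong (_% 9) e) (trans ([m+kn]%n≡m%n y b 9) (m<n⇒m%n≡m y<9)))

  c%4<9 : ∀ c → c % 4 < 9
  c%4<9 c = <-≤-trans (m%n<n c 4) (m≤m+n 4 5)

  4+c%5<9 : ∀ c → 4 + c % 5 < 9
  4+c%5<9 c = +-monoʳ-< 4 (m%n<n c 5)

tightMachine-injective : ∀ {c c′} → tightMachine c ≡ tightMachine c′ → c ≡ c′
tightMachine-injective {c} {c′} e with mixed-radix (c / 4) (c′ / 4) (c%4<9 c) (c%4<9 c′) e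
... | (x , y) = trans (m≡m%n+[m/n]*n c 4) (trans (cong₂ (λ x y → x + y * 4) x y) (sym (m≡m%n+[m/n]*n c′ 4)))

looseMachine-injective : ∀ {c c′} → looseMachine c ≡ looseMachine c′ → c ≡ c′
looseMachine-injective {c} {c′} e with mixed-radix (c / 5) (c′ / 5) (4+c%5<9 c) (4+c%5<9 c′) e
... | (x , y) = trans (m≡m%n+[m/n]*n c 5) (trans (cong₂ (λ x y → x + y * 5) (+-cancelˡ-≡ 4 _ _ x) y)
    (sym (m≡m%n+[m/n]*n c′ 5)))

tight≢loose : ∀ {c c′} → tightMachine c ≢ looseMachine c′
tight≢loose {c} {c′} e = contradiction (m%n<n c 4) (≤⇒≯ (≤-trans (m≤m+n 4 (c′ % 5))
    (≤-reflexive (sym (proj₁ (mixed-radix (c / 4) (c′ / 5) (c%4<9 c) (4+c%5<9 c′) e))))))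

tightMachine-bound : ∀ {c m} → c < m * 4 → tightMachine c < m * 9
tightMachine-bound {c} {m} c< =
    <-≤-trans (+-monoˡ-< (c / 4 * 9) (c%4<9 c)) (*-monoˡ-≤ 9 (m<n*o⇒m/o<n {c} {m} {4} c<))

looseMachine-bound : ∀ {c m} → c < m * 5 → looseMachine c < m * 9
looseMachine-bound {c} {m} c< =
    <-≤-trans (+-monoˡ-< (c / 5 * 9) (4+c%5<9 c)) (*-monoˡ-≤ 9 (m<n*o⇒m/o<n {c} {m} {5} c<))

cnt-monoʳ : (P? : Decidable P) → ∀ {m n} → m ≤ n → cnt P? m ≤ cnt P? n
cnt-monoʳ P? {m} {n} m≤n = subst (λ x → cnt P? m ≤ cnt P? x) (m∸n+n≡m m≤n) (go (n ∸ m))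
  where
  go : ∀ e → cnt P? m ≤ cnt P? (e + m)
  go zero = ≤-refl
  go (suc e) with P? (e + m)
  ... | yes _ = m≤n⇒m≤1+n (go e)
  ... | no  _ = go e

-- Schedules with one piece per job

sum-zero : ∀ (g : ℕ → ℚ) n → (∀ i → g i ≡ 0ℚ) → foldr ℚ._+_ 0ℚ (applyUpTo g n) ≡ 0ℚ
sum-zero g zero    h = refl
sum-zero g (suc n) h = trans (cong₂ ℚ._+_ (h 0) (sum-zero (g ∘ suc) n (h ∘ suc))) (ℚₚ.+-identityˡ 0ℚ)

sum-single : ∀ (g : ℕ → ℚ) n {j} → j < n → (∀ i → i ≢ j → g i ≡ 0ℚ) → foldr ℚ._+_ 0ℚ (applyUpTo g n) ≡ g j
sum-single g (suc n) {zero}  _   h =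
    trans (cong (g 0 ℚ.+_) (sum-zero (g ∘ suc) n (λ i → h (suc i) (λ ())))) (ℚₚ.+-identityʳ (g 0))
sum-single g (suc n) {suc j} j<n h = trans (cong₂ ℚ._+_ (h 0 (λ ()))
    (sum-single (g ∘ suc) n (ℕ.s≤s⁻¹ j<n) (λ i ne → h (suc i) (ne ∘ suc-injective)))) (ℚₚ.+-identityˡ _)

-- An unplaced job gets an empty piece, which never runs.
pieceAt : ℕ → ℕ → Maybe (ℕ × ℕ) → Piece
pieceAt q j (just (a , μ)) = piece j μ (ℕ→ℚ a) (ℕ→ℚ (a + q))
pieceAt q j nothing        = piece j 0 0ℚ 0ℚ

jb-pieceAt : ∀ q j x → jb (pieceAt q j x) ≡ j
jb-pieceAt q j (just _) = refl
jb-pieceAt q j nothing  = refl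

nonpreemptive : ℕ → Placement → ℕ → Schedule
nonpreemptive q f n = applyUpTo (λ j → pieceAt q j (f j)) n

module _ {I M p′} (f : Placement) (eqp : ∀ i → i < length I → p (I at i) ≡ suc p′)
  (ok : ∀ {j} → j < length I →
        ∃ λ a → ∃ λ μ → f j ≡ just (a , μ) × r (I at j) ≤ a × a + suc p′ ≤ d (I at j) × μ < M)
  (sep : ∀ {i j a b μ} → i < length I → j < length I → i ≢ j →
         f i ≡ just (a , μ) → f j ≡ just (b , μ) → a + suc p′ ≤ b ⊎ b + suc p′ ≤ a) where

  private
    q = suc p′
    n = length I
    S = nonpreemptive q f n

    index : Fin (length S) → ℕ
    index = toℕ

    index<n : ∀ k → index k < n
    index<n k = subst (toℕ k <_) (length-applyUpTo (λ j → pieceAt q j (f j)) n) (toℕ<n k)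

    at-index : ∀ k → lookup S k ≡ pieceAt q (index k) (f (index k))
    at-index k = lookup-applyUpTo (λ j → pieceAt q j (f j)) n k

    jb-index : ∀ k → jb (lookup S k) ≡ index k
    jb-index k = trans (cong jb (at-index k)) (jb-pieceAt q (index k) (f (index k)))

    disjoint : ∀ k k′ → k ≢ k′ → mach (lookup S k) ≡ mach (lookup S k′) → Disjoint (lookup S k) (lookup S k′)
    disjoint k k′ ne e rewrite at-index k | at-index k′ with ok (index<n k) | ok (index<n k′)
    ... | (a , μ , fk , _) | (b , μ′ , fk′ , _) rewrite fk | fk′ with e
    ... | refl with sep (index<n k) (index<n k′) (ne ∘ toℕ-injective) fk fk′
    ...   | inj₁ le = inj₁ (ℕ→ℚ-mono-≤ le)
    ...   | inj₂ le = inj₂ (ℕ→ℚ-mono-≤ le)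

  nonpreemptive-feasible : Feasible I M S
  nonpreemptive-feasible = record
    { wellformed = Allₚ.applyUpTo⁺₁ _ n wf
    ; window     = win
    ; machineOK  = disjoint
    -- Piece `j` belongs to job `j`, so distinct pieces never share a job.
    ; jobOK      =
        λ k k′ ne e → contradiction (toℕ-injective (trans (sym (jb-index k)) (trans e (jb-index k′)))) ne
    ; amount     = amt
    }
    where
    wf : ∀ {j} → j < n → let π = pieceAt q j (f j) in (jb π < n) × (mach π < M) × (start π ℚ.< end π)
    wf {j} j<n with ok j<n
    ... | (a , μ , fj , _ , _ , μ<M) rewrite fj = j<n , μ<M , ℕ→ℚ-mono-< (m<m+n a (s≤s z≤n))
    win : ∀ k (i : Fin n) → jb (lookup S k) ≡ toℕ i →
          (ℕ→ℚ (r (lookup I i)) ℚ.≤ start (lookup S k)) × (end (lookup S k) ℚ.≤ ℕ→ℚ (d (lookup I i)))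
    win k i e with trans (sym (jb-index k)) e
    ... | e′ rewrite at-index k | e′ | sym (at-lookup I i) with ok (toℕ<n i)
    ...   | (a , μ , fi , le , le′ , _) rewrite fi = ℕ→ℚ-mono-≤ le , ℕ→ℚ-mono-≤ le′
    amt : ∀ (i : Fin n) → processed S (toℕ i) ≡ ℕ→ℚ (p (lookup I i))
    amt i = trans (cong (foldr ℚ._+_ 0ℚ) (map-applyUpTo (λ j → pieceAt q j (f j)) contribution n))
      (trans (sum-single (contribution ∘ (λ j → pieceAt q j (f j))) n (toℕ<n i) other) own)
      where
      contribution : Piece → ℚ
      contribution π = if jb π ℕ.≡ᵇ toℕ i then end π ℚ.- start π else 0ℚ
      other : ∀ j → j ≢ toℕ i → contribution (pieceAt q j (f j)) ≡ 0ℚ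
      other j ne rewrite jb-pieceAt q j (f j) with j ℕ.≡ᵇ toℕ i | ≡ᵇ⇒≡ j (toℕ i)
      ... | true  | h = contradiction (h _) ne
      ... | false | _ = refl
      own : contribution (pieceAt q (toℕ i) (f (toℕ i))) ≡ ℕ→ℚ (p (lookup I i))
      own with ok (toℕ<n i)
      ... | (a , μ , fi , _) rewrite fi with toℕ i ℕ.≡ᵇ toℕ i | ≡⇒≡ᵇ (toℕ i) (toℕ i) refl
      ...   | true | _ = trans (ℕ→ℚ-length a q) (cong ℕ→ℚ (trans (sym (eqp _ (toℕ<n i))) (cong p (at-lookup I i))))

-- A piece running at a time `s < t` starts before `t`, so it is enough that placements with an
-- early start coincide.
nonpreemptive-runs : ∀ {q f g n n′ t j k s} → (∀ a μ → a < t → f j ≡ just (a , μ) → g j ≡ just (a , μ)) →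
  j < n′ → s ℚ.< ℕ→ℚ t → Runs (nonpreemptive q f n) k j s → Runs (nonpreemptive q g n′) k j s
nonpreemptive-runs {q} {f} {g} {n} {n′} {t} {j} {k} {s} same j<n′ s<t runs with Anyₚ.applyUpTo⁻
    (λ j → pieceAt q j (f j)) {n} runs
... | (i , _ , ji , mk , st , en) with trans (sym (jb-pieceAt q i (f i))) ji
... | refl with f j in e
...   | nothing      = contradiction (ℚₚ.≤-<-trans st en) (ℚₚ.<-irrefl refl)
...   | just (a , μ) = Anyₚ.applyUpTo⁺ (λ j → pieceAt q j (g j))
  (subst (λ x → let π = pieceAt q j x in (jb π ≡ j) × (mach π ≡ k) × (start π ℚ.≤ s) × (s ℚ.< end π))
    (sym (same a μ (ℕ→ℚ-cancel-< (ℚₚ.≤-<-trans st s<t)) refl)) (refl , mk , st , en)) j<n′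

-- Sorted instances and their released prefixes

Sorted : Instance → Set
Sorted = AllPairs (λ a b → r a ≤ r b)

sorted : ∀ {I} → SortedByRelease I → Sorted I
sorted = Linked⇒AllPairs ≤-trans

all-at : ∀ {Q : Job → Set} {I i} → All Q I → i < length I → Q (I at i)
all-at {Q} {I} {i} qs i<n = subst Q (at-fromℕ< I i<n) (All.lookup qs (∈-lookup (fromℕ< i<n)))

sorted-at : ∀ {I i j} → Sorted I → i ≤ j → j < length I → r (I at i) ≤ r (I at j)
sorted-at {x ∷ I} {zero}  {zero}  (le ∷ s) _   _   = ≤-refl
sorted-at {x ∷ I} {zero}  {suc j} (le ∷ s) _   j<n = all-at le (ℕ.s≤s⁻¹ j<n)
sorted-at {x ∷ I} {suc i} {suc j} (le ∷ s) i≤j j<n = sorted-at s (ℕ.s≤s⁻¹ i≤j) (ℕ.s≤s⁻¹ j<n)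

releasedBefore-accept : ∀ t {x} I → r x < t → releasedBefore t (x ∷ I) ≡ x ∷ releasedBefore t I
releasedBefore-accept t I = filter-accept (λ j → r j <? t)

releasedBefore-none : ∀ t {x I} → Sorted (x ∷ I) → ¬ r x < t → releasedBefore t (x ∷ I) ≡ []
releasedBefore-none t (le ∷ _) ¬lt =
    filter-none (λ j → r j <? t) (¬lt ∷ All.map (λ x≤y lt → ¬lt (≤-<-trans x≤y lt)) le)

Prefix : Instance → Instance → Set
Prefix I L = ∀ i → i < length L → I at i ≡ L at i

-- In sorted order, once a release reaches `t` all later ones do, so the filter keeps an initial
-- segment and positions are unchanged.
released-prefix : ∀ t {I} → Sorted I → Prefix I (releasedBefore t I)
released-prefix t {[]}    _ i ()
released-prefix t {x ∷ I} s@(_ ∷ s′) with r x <? t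
... | no ¬lt = subst (Prefix (x ∷ I)) (sym (releasedBefore-none t s ¬lt)) λ _ ()
... | yes lt = subst (Prefix (x ∷ I)) (sym (releasedBefore-accept t I lt))
  λ { zero _ → refl ; (suc i) i<b → released-prefix t s′ i (ℕ.s≤s⁻¹ i<b) }

LateSuffix : ℕ → Instance → Instance → Set
LateSuffix t I L = ∀ i → length L ≤ i → i < length I → t ≤ r (I at i)

unreleased-suffix : ∀ t {I} → Sorted I → LateSuffix t I (releasedBefore t I)
unreleased-suffix t {[]}    _ i _ ()
unreleased-suffix t {x ∷ I} s@(_ ∷ s′) with r x <? t
... | no ¬lt = λ i _ i<n → ≤-trans (≮⇒≥ ¬lt) (sorted-at s z≤n i<n)
... | yes lt = subst (LateSuffix t (x ∷ I)) (sym (releasedBefore-accept t I lt))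
  λ { (suc i) b≤i i<n → unreleased-suffix t s′ i (ℕ.s≤s⁻¹ b≤i) (ℕ.s≤s⁻¹ i<n) }

-- The algorithm and its non-anticipation

module Algorithm (p′ : ℕ) (J : ℕ → Job) (n : ℕ) where
  open Classes p′ J public
  open Colouring p′ J public
  open EDF p′ J n public

  toPlacement : ℕ × ℕ → ℕ × ℕ
  toPlacement (k , c) = k * q , looseMachine c

  placement : Placement
  placement j with loose? j
  ... | no  _ = just (r (J j) , tightMachine (colour j))
  ... | yes _ = Maybe.map toPlacement (edf (deadline j) j)

  -- The graph of `placement`, so that later proofs can match on the kind of job and not repeat the
  -- nested case distinction.
  data Placed (j a μ : ℕ) : Set where
    tight : ¬ Loose j → a ≡ r (J j) → μ ≡ tightMachine (colour j) → Placed j a μ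
    loose : ∀ {k c} → Loose j → edf (deadline j) j ≡ just (k , c) → a ≡ k * q → μ ≡ looseMachine c → Placed j a μ

  placed : ∀ {j a μ} → placement j ≡ just (a , μ) → Placed j a μ
  placed {j} e with loose? j
  placed {j} refl | no ¬l = tight ¬l refl refl
  ... | yes l with edf (deadline j) j in s
  placed {j} refl | yes l | just (k , c) = loose l s refl refl

  placed⁻¹ : ∀ {j a μ} → Placed j a μ → placement j ≡ just (a , μ)
  placed⁻¹ {j} (tight ¬l refl refl) with loose? j
  ... | yes l = contradiction l ¬l
  ... | no  _ = refl
  placed⁻¹ {j} (loose l e refl refl) with loose? j
  ... | no ¬l = contradiction l ¬l
  ... | yes _ rewrite e = refl

module _ (p′ : ℕ) (J J′ : ℕ → Job) {n n′ b t : ℕ} (b≤n : b ≤ n) (b≤n′ : b ≤ n′)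
  (agree : ∀ i → i < b → J i ≡ J′ i)
  (late  : ∀ i → b ≤ i → i < n → t ≤ r (J i))
  (late′ : ∀ i → b ≤ i → i < n′ → t ≤ r (J′ i)) where

  -- A tight job starts at its release with a colour computed from jobs up to `j`. A loose job with
  -- start `a < t` sits in a slot beginning before `t`, which `early-slot-agree` covers.
  placement-agree : ∀ {j a μ} → j < b → a < t →
    Algorithm.placement p′ J n j ≡ just (a , μ) → Algorithm.placement p′ J′ n′ j ≡ just (a , μ)
  placement-agree {j} j<b a<t e with Algorithm.placed p′ J n e
  ... | Algorithm.tight ¬l x y = Algorithm.placed⁻¹ p′ J′ n′ (Algorithm.tight
    (subst (λ x → ¬ (r x + 3 * suc p′ ≤ d x)) (agree j j<b) ¬l) (trans x (cong r (agree j j<b)))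
    (trans y (cong tightMachine (ColouringAgree.colour-agree p′ J J′ b agree j<b))))
  ... | Algorithm.loose {k} {c} l x y z = Algorithm.placed⁻¹ p′ J′ n′ (Algorithm.loose
    (subst (λ x → r x + 3 * suc p′ ≤ d x) (agree j j<b) l)
    (trans (cong (λ x → EDF.edf p′ J′ n′ (d x / suc p′) j) (sym (agree j j<b)))
      (EDFAgree.early-slot-agree p′ J J′ b≤n b≤n′ agree late late′ {d (J j) / suc p′} {j}
          (subst (_< t) y a<t) x)) y z)

schedule : ℕ → Instance → Schedule
schedule zero     I = []
schedule (suc p′) I = nonpreemptive (suc p′) (Algorithm.placement p′ (I at_) (length I)) (length I)

-- The common processing time is known from the first release on. The dummy job makes an empty
-- instance yield the empty schedule.
algorithm : Instance → Schedule
algorithm I = schedule (p (I at 0)) I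

algorithm-online : Online algorithm
algorithm-online I I′ t (s , _) (s′ , _) e j k x j<b x<t =
    mk⇔ (half I I′ s s′ e j<b) (half I′ I s′ s (sym e) (subst (λ L → j < length L) e j<b))
  where
  half : ∀ I I′ → SortedByRelease I → SortedByRelease I′ → releasedBefore t I ≡ releasedBefore t I′ →
         j < length (releasedBefore t I) → Runs (algorithm I) k j x → Runs (algorithm I′) k j x
  -- As `j < b`, the first job lies in the common prefix, so both runs use the same processing time.
  half I I′ s s′ e j<b = subst (λ P → Runs (algorithm I) k j x → Runs (schedule P I′) k j x)
      (cong p (agree 0 (≤-<-trans z≤n j<b))) (core (p (I at 0)))
    where
    b = length (releasedBefore t I)
    e′ : b ≡ length (releasedBefore t I′)
    e′ = cong length e
    agree : ∀ i → i < b → I at i ≡ I′ at i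
    agree i i<b = trans (released-prefix t (sorted s) i i<b)
      (trans (cong (_at i) e) (sym (released-prefix t (sorted s′) i (subst (i <_) e′ i<b))))
    b≤n′ : b ≤ length I′
    b≤n′ = subst (_≤ length I′) (sym e′) (length-filter (λ j → r j <? t) I′)
    core : ∀ P → Runs (schedule P I) k j x → Runs (schedule P I′) k j x
    core zero     ()
    core (suc p′) = nonpreemptive-runs {n = length I}
      (λ a μ a<t → placement-agree p′ (I at_) (I′ at_) (length-filter (λ j → r j <? t) I) b≤n′ agree
        (unreleased-suffix t (sorted s)) (λ i b≤i → unreleased-suffix t (sorted s′) i
            (subst (_≤ i) e′ b≤i)) j<b a<t)
      (<-≤-trans j<b b≤n′) x<t

-- Feasibility on nine times the optimal number of machines

module Correct {I m S} (F : Feasible I m S) (p′ : ℕ) (eqp : ∀ i → i < length I → p (I at i) ≡ suc p′)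
    (srt : Sorted I) where
  n = length I
  J = I at_
  open Algorithm p′ J n
  open Load F q eqp using (load; window-length)

  -- A single job has positive volume inside `[0, d]`. The strict inequality in `guess≤m` needs
  -- this, being multiplied by `m`.
  m≥1 : ∀ {i} → i < n → 1 ≤ m
  m≥1 {i} i<n = factor m (≤-trans (*-mono-≤ (cnt-pos only? n i<n refl) (s≤s (z≤n {p′})))
    (load only? 0 (d (J i)) (λ { _ _ refl → z≤n , ≤-refl })))
    where
    only? : Decidable (_≡ i)
    only? j = j ℕₚ.≟ i
    factor : ∀ x {y} → 1 ≤ x * y → 1 ≤ x
    factor (suc _) _ = s≤s z≤n

  colour<4m : ∀ {j} → j < n → ¬ Loose j → colour j < m * 4
  colour<4m {j} j<n ¬l = begin-strict
    colour j               ≤⟨ colour-bound j ⟩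
    cnt (conflict? j) j    ≤⟨ cnt-mono (conflict? j) earlier? j (λ i i<j c → c , i<j) ⟩
    cnt earlier? j         ≤⟨ cnt-monoʳ earlier? (<⇒≤ j<n) ⟩
    -- Counting `j` itself as well makes the bound strict, as a colour requires.
    cnt earlier? n         <⟨ cnt-strict earlier? upTo? n (λ { _ _ (c , lt) → c , <⇒≤ lt }) j<n
        ((¬l , m<m+n (r (J j)) (s≤s z≤n)) , ≤-refl) (λ (_ , lt) → <-irrefl refl lt) ⟩
    cnt upTo? n            ≤⟨ *-cancelʳ-≤ _ _ q (≤-trans (load upTo? (r (J j) ∸ p′) (4 * q) win)
        (≤-reflexive (sym (*-assoc m 4 q)))) ⟩
    m * 4                  ∎
    where
    open ≤-Reasoning hiding (start)
    earlier? : Decidable (λ i → Conflict j i × i < j)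
    earlier? i = conflict? j i ×-dec (i <? j)
    upTo? : Decidable (λ i → Conflict j i × i ≤ j)
    upTo? i = conflict? j i ×-dec (i ≤? j)
    arith : ∀ x p → x + p + 3 * suc p ≤ x + 4 * suc p
    arith x p = ≤-trans (n≤1+n _) (≤-reflexive (lemma x p))
      where
      lemma : ∀ x p → suc (x + p + 3 * suc p) ≡ x + 4 * suc p
      lemma = solve-∀
    -- A job running at `r (J j)` was released at most `p′` earlier, and being tight it is due
    -- before `r (J j) + 3 * q`. Truncation of `r (J j) ∸ p′` to 0 only makes the interval reach
    -- farther right.
    win : ∀ i → i < n → Conflict j i × i ≤ j → r (J j) ∸ p′ ≤ r (J i) × d (J i) ≤ r (J j) ∸ p′ + 4 * q
    win i i<n ((¬li , lt) , i≤j) =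
      m≤n+o⇒m∸n≤o (r (J j)) p′ (ℕ.s≤s⁻¹ (≤-trans lt (≤-reflexive
          (trans (+-suc (r (J i)) p′) (cong suc (+-comm (r (J i)) p′)))))) , (begin
        d (J i)                           ≤⟨ <⇒≤ (≰⇒> ¬li) ⟩
        r (J i) + 3 * q                   ≤⟨ +-monoˡ-≤ (3 * q) (sorted-at srt i≤j j<n) ⟩
        r (J j) + 3 * q                   ≤⟨ +-monoˡ-≤ (3 * q) (m≤n+m∸n (r (J j)) p′) ⟩
        p′ + (r (J j) ∸ p′) + 3 * q       ≡⟨ cong (_+ 3 * q) (+-comm p′ _) ⟩
        r (J j) ∸ p′ + p′ + 3 * q         ≤⟨ arith (r (J j) ∸ p′) p′ ⟩
        r (J j) ∸ p′ + 4 * q              ∎)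

  guess≤m : ∀ {i} → i < n → ∀ k → guess k ≤ m
  guess≤m i<n k = guess-least k density<m
    where
    open ≤-Reasoning hiding (start)
    density<m : ∀ X u → cnt (inside? k X u) n < m * (2 + X)
    density<m X u = *-cancelʳ-< q _ _ (begin-strict
      cnt (inside? k X u) n * q        ≤⟨ load (inside? k X u) (c * q) l win ⟩
      m * l                            <⟨ *-monoʳ-< m {{ℕ.>-nonZero (m≥1 i<n)}} ≤-refl ⟩
      m * ((2 + X) * q)                ≡⟨ *-assoc m (2 + X) q ⟨
      m * (2 + X) * q                  ∎)
      where
      -- Slot `c` precedes the earliest admissible slot, and is 0 if the interval would begin before
      -- time 0. The length `l` is `(2 + X) * q - 1`, one unit short of the extended interval, which
      -- gives the strict bound.
      c = (k + u) ∸ suc X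
      l = p′ + suc X * q
      lower : ∀ i → k + u ≤ first i + X → c * q ≤ r (J i)
      lower i le with c in e
      ... | zero   = z≤n
      ... | suc c′ = +-cancelʳ-≤ p′ _ _ (begin
        suc c′ * q + p′          ≤⟨ +-monoʳ-≤ (suc c′ * q) (n≤1+n p′) ⟩
        suc c′ * q + q           ≡⟨ +-comm _ q ⟩
        suc (suc c′) * q         ≤⟨ *-monoˡ-≤ q (≤-trans (s≤s (≤-reflexive (sym e))) first-big) ⟩
        first i * q              ≤⟨ first-upper i ⟩
        r (J i) + p′             ∎)
        where
        X<k+u : suc X ≤ k + u
        X<k+u with suc X ≤? k + u
        ... | yes le = le
        ... | no ¬le = contradiction (trans (sym e) (m≤n⇒m∸n≡0 (<⇒≤ (≰⇒> ¬le)))) λ ()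
        first-big : suc c ≤ first i
        first-big = +-cancelʳ-≤ X _ _ (begin
          suc c + X        ≡⟨ +-suc c X ⟨
          c + suc X        ≡⟨ m∸n+n≡m X<k+u ⟩
          k + u            ≤⟨ le ⟩
          first i + X      ∎)
      win : ∀ i → i < n → Inside k X u i → c * q ≤ r (J i) × d (J i) ≤ c * q + l
      win i _ (_ , dl , le) = lower i le , ℕ.s≤s⁻¹ (begin-strict
        d (J i)                        <⟨ deadline-lower i ⟩
        suc (deadline i) * q           ≤⟨ *-monoˡ-≤ q (s≤s dl) ⟩
        suc (k + u) * q                ≤⟨ *-monoˡ-≤ q (s≤s (m≤n+m∸n (k + u) (suc X))) ⟩
        suc (suc X + c) * q            ≡⟨ *-distribʳ-+ q (suc (suc X)) c ⟩
        suc l + c * q                  ≡⟨ cong suc (+-comm l (c * q)) ⟩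
        suc (c * q + l)                ∎)

  slot : ∀ {i k c} → edf (deadline i) i ≡ just (k , c) → first i ≤ k × k < deadline i × c < capacity k
  slot {i} e with Good.sound (Good-edf (deadline i)) e
  ... | (_ , (_ , le) , c< , inj₁ lt) = le , lt , c<

  placement-ok : ∀ {j} → j < n → ∃ λ a → ∃ λ μ → placement j ≡ just (a , μ) ×
                 r (J j) ≤ a × a + q ≤ d (J j) × μ < m * 9
  placement-ok {j} j<n with loose? j
  ... | no ¬l = r (J j) , tightMachine (colour j) , refl , ≤-refl ,
      window-length (s≤s z≤n) j<n , tightMachine-bound {colour j} {m} (colour<4m j<n ¬l)
  ... | yes l with edf-meets-deadlines j<n l
  ...   | ((k , c) , e) rewrite e with slot {j} e
  ...     | (fst≤k , k<dl , c<) = k * q , looseMachine c , refl , ≤-trans (first-lower j) (*-monoˡ-≤ q fst≤k) ,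
    ≤-trans (≤-reflexive (+-comm (k * q) q)) (≤-trans (*-monoˡ-≤ q k<dl) (deadline-upper j)) ,
    looseMachine-bound {c} {m} (<-≤-trans c< (*-monoˡ-≤ 5 (guess≤m j<n k)))

  -- The two entries come from different stages; both persist to the later one, where `inj` applies.
  edf-injective : ∀ {i j v} → edf (deadline i) i ≡ just v → edf (deadline j) j ≡ just v → i ≡ j
  edf-injective {i} {j} x y = Good.inj (Good-edf (deadline i ⊔ deadline j))
    (Later-just (edf-Later-≤ (m≤m⊔n (deadline i) (deadline j))) x)
        (Later-just (edf-Later-≤ (m≤n⊔m (deadline i) (deadline j))) y)

  -- Tight and loose jobs never share a machine. Two tight jobs on one machine have the same colour,
  -- so they do not conflict; two loose ones have the same position, so they are in different slots.
  placement-sep : ∀ {i j a b μ} → i < n → j < n → i ≢ j →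
                  placement i ≡ just (a , μ) → placement j ≡ just (b , μ) → a + q ≤ b ⊎ b + q ≤ a
  placement-sep {i} {j} _ _ i≢j x y with placed x | placed y
  ... | tight _ _ e | loose {k} {c} _ _ _ e′ = contradiction (trans (sym e) e′) (tight≢loose {colour i} {c})
  ... | loose {k} {c} _ _ _ e | tight _ _ e′ = contradiction (trans (sym e′) e) (tight≢loose {colour j} {c})
  ... | tight ¬l refl e | tight ¬l′ refl e′ with tightMachine-injective {colour i} {colour j}
      (trans (sym e) e′) | <-cmp i j
  ...   | same | tri< i<j _ _ = inj₁ (≮⇒≥ (λ lt → colour-proper i<j (¬l , lt) same))
  ...   | same | tri≈ _ i≡j _ = contradiction i≡j i≢j
  ...   | same | tri> _ _ j<i = inj₂ (≮⇒≥ (λ lt → colour-proper j<i (¬l′ , lt) (sym same)))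
  placement-sep {i} {j} _ _ i≢j x y | loose {k} {c} _ s refl e | loose {k′} {c′} _ s′ refl e′
    with looseMachine-injective {c} {c′} (trans (sym e) e′) | <-cmp k k′
  ...   | refl | tri< k<k′ _ _ = inj₁ (≤-trans (≤-reflexive (+-comm (k * q) q)) (*-monoˡ-≤ q k<k′))
  ...   | refl | tri≈ _ refl _ = contradiction (edf-injective s s′) i≢j
  ...   | refl | tri> _ _ k′<k = inj₂ (≤-trans (≤-reflexive (+-comm (k′ * q) q)) (*-monoˡ-≤ q k′<k))

  feasible : Feasible I (m * 9) (schedule (suc p′) I)
  feasible = nonpreemptive-feasible placement eqp placement-ok placement-sep

-- The competitive ratio

algorithm-competitive : Competitive 938 100 algorithm
algorithm-competitive I (srt , p₀ , eqs) m ((S , F) , _) = go (p (I at 0)) refl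
  where
  eqp : ∀ i → i < length I → p (I at i) ≡ p (I at 0)
  eqp i i<n = trans (all-at eqs i<n) (sym (all-at eqs (≤-<-trans z≤n i<n)))
  eqp-lookup : ∀ i → p (lookup I i) ≡ p (I at 0)
  eqp-lookup i = trans (cong p (sym (at-lookup I i))) (eqp (toℕ i) (toℕ<n i))
  go : ∀ P → p (I at 0) ≡ P → ∃ λ M → Feasible I M (schedule P I) × (100 * M ≤ 938 * m)
  -- Jobs of length 0 need no pieces, so the empty schedule on no machines is feasible.
  go zero e = 0 , record
    { wellformed = []
    ; window     = λ ()
    ; machineOK  = λ ()
    ; jobOK      = λ ()
    ; amount     = λ i → sym (cong ℕ→ℚ (trans (eqp-lookup i) e))
    } , z≤n
  go (suc p′) e = m * 9 , Correct.feasible F p′ (λ i i<n → trans (eqp i i<n) e) (sorted srt) , (begin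
    100 * (m * 9)   ≡⟨ cong (100 *_) (*-comm m 9) ⟩
    100 * (9 * m)   ≡⟨ *-assoc 100 9 m ⟨
    -- The ratio achieved is 9, below the required 9.38.
    900 * m         ≤⟨ *-monoˡ-≤ m (m≤m+n 900 38) ⟩
    938 * m         ∎)
    where open ≤-Reasoning hiding (start)

theorem10 : ∃ λ (A : Instance → Schedule) → Online A × Competitive 938 100 A
theorem10 = algorithm , algorithm-online , algorithm-competitive
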